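{- For each $n\ge1$, $SH_n=\sum_{(p,\overline{\sigma})\in\mathrm{Gar}(n)}R_{\lambda(p)}$.
   Context: Parking functions: an $n$-tuple $p$ of positive integers whose $i$-th smallest entry is at most $i$ for each $i$; $\mathrm{Pf}(n)$ their set; $p$ sorted if weakly increasing; $\alpha_k(p)=\#\{j:p_j=k\}$; $\lambda(p)$ the partition formed by the nonzero $\alpha_k(p)$. A sorted naive shifted parking function of size $n$ is a pair $(p,\overline{\sigma})$ with $p\in\mathrm{Pf}(n)$ sorted and $\overline{\sigma}\in\{ -1,0,1\}^n$ with $\overline{\sigma}_k=0$ iff $\alpha_k(p)=0$. Let $\upsilon_i=0,1,2$ according as $\alpha_i(p)=0$, $\alpha_i(p)$ odd, or $\alpha_i(p)>0$ even. $(p,\overline{\sigma})$ is a garage if for all $i<j$ with $\upsilon_i=\upsilon_j=2$ such that every prefix of the word $\upsilon_{i+1}\cdots\upsilon_{j-1}$ has at least as many $2$'s as $0$'s, $\overline{\sigma}_i=\overline{\sigma}_j$. $\mathrm{Gar}(n)$ is the set of garages of size $n$. Symmetric functions: $h_k,e_k,p_k$ complete homogeneous, elementary, power sums; $P_0=1$, $P_k=\frac12\sum_{i=0}^kh_ie_{k-i}$ for $k\geq 1$; $R_m=P_m$ for $m$ odd and $R_m=\sum_{i=1}^{m/2}P_{2i}P_{m-2i}$ for $m$ even; $R_\lambda=\prod_iR_{\lambda_i}$. $\mathtt{sh}$ is the algebra endomorphism of $\mathrm{Sym}$ with $p_{2k-1}\mapsto2p_{2k-1}$, $p_{2k}\mapsto0$;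 $PF_n=\sum h_{\lambda(p)}$ over sorted $p\in\mathrm{Pf}(n)$; $SH_n=\mathtt{sh}(PF_n)$. -}

module Defs where

open import Data.Nat as ℕ using (ℕ; zero; suc; _≡ᵇ_; _≤ᵇ_; _<ᵇ_; _∸_; ⌊_/2⌋)
open import Data.Integer as ℤ using (ℤ; +_; -[1+_])
open import Data.Rational as ℚ using (ℚ; 0ℚ; 1ℚ; ½)
open import Data.Bool using (Bool; true; false; not; _∧_; _∨_; if_then_else_)
open import Data.List using (List; []; _∷_; [_]; _++_; map; concatMap; foldr; filterᵇ; upTo; zipWith; length; take)
open import Data.Product using (_×_; _,_; proj₁; proj₂)
open import Relation.Nullary.Decidable using (⌊_⌋)
open import Relation.Binary.PropositionalEquality using (_≡_)

-- Sym over ℚ, realised in the power-sum basis: Sym_ℚ = ℚ[p₁,p₂,…].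
-- An element is a formal finite ℚ-linear combination of products
-- p_μ = p_{μ₁} p_{μ₂} ⋯ , μ a finite multiset (list) of positive integers.

Sym : Set
Sym = List (ℚ × List ℕ)

pw : ℕ → Sym
pw k = [ (1ℚ , [ k ]) ]

𝟙 : Sym
𝟙 = [ (1ℚ , []) ]

_⊕_ : Sym → Sym → Sym
f ⊕ g = f ++ g

_⊙_ : ℚ → Sym → Sym
c ⊙ f = map (λ t → (c ℚ.* proj₁ t , proj₂ t)) f

_⊗_ : Sym → Sym → Sym
f ⊗ g = concatMap (λ s → map (λ t → (proj₁ s ℚ.* proj₁ t , proj₂ s ++ proj₂ t)) g) f

Σˢ : List Sym → Sym
Σˢ = foldr _⊕_ []

Πˢ : List Sym → Sym
Πˢ = foldr _⊗_ 𝟙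

insert : ℕ → List ℕ → List ℕ
insert x [] = [ x ]
insert x (y ∷ ys) = if x ≤ᵇ y then x ∷ y ∷ ys else y ∷ insert x ys

sort : List ℕ → List ℕ
sort = foldr insert []

eqℕs : List ℕ → List ℕ → Bool
eqℕs [] [] = true
eqℕs (x ∷ xs) (y ∷ ys) = (x ≡ᵇ y) ∧ eqℕs xs ys
eqℕs _ _ = false

coeff : List ℕ → Sym → ℚ
coeff μ f = foldr ℚ._+_ 0ℚ (map proj₁ (filterᵇ (λ t → eqℕs (sort (proj₂ t)) (sort μ)) f))

infix 4 _≈_
_≈_ : Sym → Sym → Set
f ≈ g = ∀ (μ : List ℕ) → coeff μ f ≡ coeff μ g

-- the algebra endomorphism sh : p_{2k-1} ↦ 2 p_{2k-1}, p_{2k} ↦ 0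
odd : ℕ → Bool
odd zero = false
odd (suc n) = not (odd n)

shFactor : ℕ → ℚ
shFactor k = if odd k then ℚ.1ℚ ℚ.+ ℚ.1ℚ else 0ℚ

sh : Sym → Sym
sh f = map (λ t → (proj₁ t ℚ.* foldr ℚ._*_ 1ℚ (map shFactor (proj₂ t)) , proj₂ t)) f

allB : {A : Set} → (A → Bool) → List A → Bool
allB p = foldr (λ x b → p x ∧ b) true

-- h_k and e_k via Newton's identities
--   k h_k = Σ_{i=1}^k p_i h_{k-i},   k e_k = Σ_{i=1}^k (-1)^{i-1} p_i e_{k-i}.
-- newton s k = [x_k, x_{k-1}, …, x_0] where k x_k = Σ_{i=1}^k s(i) p_i x_{k-i}, x_0 = 1.
newton : (ℕ → ℚ) → ℕ → List Sym
newton s zero = 𝟙 ∷ []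
newton s (suc k) =
  ((+ 1 ℚ./ suc k) ⊙ Σˢ (zipWith (λ i x → (s (suc i) ⊙ pw (suc i)) ⊗ x) (upTo (suc k)) (newton s k)))
  ∷ newton s k

hd : List Sym → Sym
hd [] = []
hd (x ∷ _) = x

h : ℕ → Sym
h k = hd (newton (λ _ → 1ℚ) k)

e : ℕ → Sym
e k = hd (newton (λ i → if odd i then 1ℚ else ℚ.- 1ℚ) k)

P : ℕ → Sym
P zero = 𝟙
P (suc k) = ½ ⊙ Σˢ (map (λ i → h i ⊗ e (suc k ∸ i)) (upTo (suc (suc k))))

R : ℕ → Sym
R m = if odd m then P m
      else Σˢ (map (λ j → P (2 ℕ.* suc j) ⊗ P (m ∸ 2 ℕ.* suc j)) (upTo ⌊ m /2⌋))

Rλ : List ℕ → Sym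
Rλ μ = Πˢ (map R μ)

hλ : List ℕ → Sym
hλ μ = Πˢ (map h μ)

range1 : ℕ → List ℕ
range1 n = map suc (upTo n)

tuples : {A : Set} → ℕ → List A → List (List A)
tuples zero xs = [ [] ]
tuples (suc n) xs = concatMap (λ x → map (x ∷_) (tuples n xs)) xs

sortedB : List ℕ → Bool
sortedB [] = true
sortedB (x ∷ []) = true
sortedB (x ∷ y ∷ xs) = (x ≤ᵇ y) ∧ sortedB (y ∷ xs)

boundB : ℕ → List ℕ → Bool
boundB i [] = true
boundB i (x ∷ xs) = (1 ≤ᵇ x) ∧ (x ≤ᵇ i) ∧ boundB (suc i) xs

isPF : List ℕ → Bool
isPF p = boundB 1 (sort p)

-- sorted parking functions of size n (entries of a parking function of size n lie in 1..n)
SPf : ℕ → List (List ℕ)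
SPf n = filterᵇ (λ p → sortedB p ∧ isPF p) (tuples n (range1 n))

α : ℕ → List ℕ → ℕ
α k p = length (filterᵇ (k ≡ᵇ_) p)

-- λ(p): the nonzero α_k(p) (as a multiset; order irrelevant)
lam : List ℕ → List ℕ
lam p = filterᵇ (λ a → not (a ≡ᵇ 0)) (map (λ k → α k p) (range1 (length p)))

PF : ℕ → Sym
PF n = Σˢ (map (λ p → hλ (lam p)) (SPf n))

SH : ℕ → Sym
SH n = sh (PF n)

-- 1-indexed lookup (default 0)
ith : ℕ → List ℤ → ℤ
ith _ [] = + 0
ith zero (x ∷ _) = + 0
ith (suc zero) (x ∷ _) = x
ith (suc (suc i)) (_ ∷ xs) = ith (suc i) xs

eqℤ : ℤ → ℤ → Bool
eqℤ x y = ⌊ x ℤ.≟ y ⌋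

signs : List ℤ
signs = ℤ.- (+ 1) ∷ + 0 ∷ + 1 ∷ []

υ : List ℕ → ℕ → ℕ
υ p i = if α i p ≡ᵇ 0 then 0 else (if odd (α i p) then 1 else 2)

cnt : ℕ → List ℕ → ℕ
cnt a w = length (filterᵇ (a ≡ᵇ_) w)

prefixOK : List ℕ → Bool
prefixOK w = allB (λ k → cnt 0 (take k w) ≤ᵇ cnt 2 (take k w)) (upTo (suc (length w)))

compatB : ℕ → List ℕ → List ℤ → Bool
compatB n p σ = allB (λ k → eqℤ (ith k σ) (+ 0) ∧ (α k p ≡ᵇ 0) ∨ not (eqℤ (ith k σ) (+ 0)) ∧ not (α k p ≡ᵇ 0)) (range1 n)

between : List ℕ → ℕ → ℕ → List ℕ
between p i j = map (λ t → υ p (suc i ℕ.+ t)) (upTo (j ∸ i ∸ 1))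

garageB : ℕ → List ℕ → List ℤ → Bool
garageB n p σ =
  allB (λ i → allB (λ j →
    not ((i <ᵇ j) ∧ (υ p i ≡ᵇ 2) ∧ (υ p j ≡ᵇ 2) ∧ prefixOK (between p i j))
    ∨ eqℤ (ith i σ) (ith j σ)) (range1 n)) (range1 n)

SNSPf : ℕ → List (List ℕ × List ℤ)
SNSPf n = filterᵇ (λ g → compatB n (proj₁ g) (proj₂ g))
            (concatMap (λ p → map (p ,_) (tuples n signs)) (SPf n))

Gar : ℕ → List (List ℕ × List ℤ)
Gar n = filterᵇ (λ g → garageB n (proj₁ g) (proj₂ g)) (SNSPf n)

{-# OPTIONS --safe #-}

-- Since sh (h k) = Σ h_i e_{k-i} = 2 P_k for k ≥ 1, SH n is the sum over sorted parking functions
-- of the products of 2 P_{α_k} over the occupied spots k. For the other side read an even spot as an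
-- opening and an empty spot as a closing bracket. The garage condition says that all even spots
-- inside an outermost bracket share their sign, so a parking function underlies 2^(#odd spots +
-- #outermost brackets) garages. Now expand R_{2m} = Σ P_{2i} P_{2m-2i} and move the second factor
-- from the opening spot to the matching closing one: this turns garages into parking functions in
-- which, reading from left to right, an even spot met at depth 0 is an opening (with two signs) and
-- one met at positive depth is either an opening or a closing, hence the factor 2 per even spot.
-- The parking condition survives because the number of surplus cars is never below the depth.
module Submission where

open import Defs
open import Algebra.Bundles using (CommutativeSemiring; CommutativeMonoid)
import Algebra.Properties.CommutativeSemigroup as CommSemigroup
open import Algebra.Structures.Biased using (isCommutativeSemiringˡ)
open import Data.Bool using (Bool; true; false; if_then_else_; not; _∧_; _∨_; T)
open import Data.Bool.Properties using (T-∧)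
open import Data.Empty using (⊥-elim)
open import Data.Integer as ℤ using (ℤ; +_)
open import Data.Integer.Tactic.RingSolver using (solve-∀)
open import Data.List using (List; []; _∷_; [_]; _++_; map; concatMap; foldr; filterᵇ; zipWith; upTo; applyUpTo; take; length; replicate; cartesianProductWith)
open import Data.List.Membership.Propositional using (_∈_)
import Data.List.Membership.Propositional.Properties as ∈ₚ
open import Data.List.Membership.Propositional.Properties.WithK using (unique∧set⇒bag)
import Data.List.Properties as Listₚ
open import Data.List.Relation.Binary.BagAndSetEquality using (∼bag⇒↭)
open import Data.List.Relation.Binary.Permutation.Propositional as ↭ using (_↭_)
import Data.List.Relation.Binary.Permutation.Propositional.Properties as ↭ₚ
open import Data.List.Relation.Unary.All as All using (All; []; _∷_)
import Data.List.Relation.Unary.All.Properties as Allₚ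
open import Data.List.Relation.Unary.AllPairs using ([]; _∷_)
open import Data.List.Relation.Unary.Any using (here; there)
open import Data.List.Relation.Unary.Unique.Propositional using (Unique)
import Data.List.Relation.Unary.Unique.Propositional.Properties as Uniqueₚ
open import Data.Nat as ℕ using (ℕ; zero; suc; _≤_; _<_; _∸_; ⌊_/2⌋; z≤n; s≤s; _≡ᵇ_; _<ᵇ_; _≤ᵇ_)
import Data.Nat.Properties as ℕₚ
open import Data.Product using (_×_; _,_; proj₁; proj₂; ∃)
open import Data.Rational as ℚ using (ℚ; 0ℚ; 1ℚ; ½)
import Data.Rational.Properties as ℚₚ
open import Data.Rational.Unnormalised as ℚᵘ using (mkℚᵘ; *≡*)
import Data.Rational.Unnormalised.Properties as ℚᵘₚ
open import Data.Sum using (_⊎_; inj₁; inj₂; [_,_]′)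
open import Data.Unit using (⊤; tt)
open import Function using (_∘_; id; _⇔_; mk⇔; Equivalence)
open import Level using (0ℓ)
open import Relation.Binary.Definitions using (tri<; tri≈; tri>)
open import Relation.Binary.PropositionalEquality as ≡ using (_≡_; _≢_; cong; cong₂; module ≡-Reasoning)
open import Relation.Binary.Structures using (IsEquivalence)
open import Relation.Nullary using (yes; no)
open import Relation.Nullary.Decidable using (T?; toWitness; fromWitness; toWitnessFalse; fromWitnessFalse)
open Equivalence using (to; from)


-- Convolution of sequences over a commutative semiring

-- The transfer of cars is never carried out on individual garages. Stripping the first spot gives a
-- recursion for each side, and the two totals are compared by induction on the number of spots. The
-- induction must start in the middle of a word, where `d` brackets are open and a share of each
-- opening's cars is still due at its closing spot. `pending d` convolves these `d` shares into
-- `G n d`, and the claim is that the result equals `F n m`, whatever `d` is, as long as m + d ≤ n.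
-- This bound survives every step: an odd spot uses at least one car, an opening at least two (hence
-- the hypotheses that `O 0`, `E 0` and `E 1` vanish), and a closing lowers `d`. Only an empty spot
-- at depth 0 can break it, and then so many cars remain that both totals are zero. With no spot
-- left the bound forces `d` to be 0, so every opening does have its closing spot.

module Convolution {c ℓ} (S : CommutativeSemiring c ℓ) where
  open CommutativeSemiring S renaming (Carrier to A; _≈_ to _≃_)
  open import Algebra.Solver.Ring.NaturalCoefficients.Default S using (solve; _:+_; _:*_; _:=_; con)
  open import Relation.Binary.Reasoning.Setoid setoid

  conv : (ℕ → A) → (ℕ → A) → ℕ → A
  conv f g zero = f 0 * g 0
  conv f g (suc m) = f 0 * g (suc m) + conv (f ∘ suc) g m

  infixl 6 _⊞_
  _⊞_ : (ℕ → A) → (ℕ → A) → ℕ → A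
  (f ⊞ g) i = f i + g i

  infixr 7 _·_
  _·_ : A → (ℕ → A) → ℕ → A
  (a · f) i = a * f i

  δ : ℕ → A
  δ zero = 1#
  δ (suc _) = 0#

  conv-cong : ∀ {f f′ g g′} m → (∀ i → i ≤ m → f i ≃ f′ i) → (∀ i → i ≤ m → g i ≃ g′ i) →
              conv f g m ≃ conv f′ g′ m
  conv-cong zero p q = *-cong (p 0 z≤n) (q 0 z≤n)
  conv-cong (suc m) p q = +-cong (*-cong (p 0 z≤n) (q (suc m) ℕₚ.≤-refl))
    (conv-cong m (λ i i≤m → p (suc i) (s≤s i≤m)) (λ i i≤m → q i (ℕₚ.m≤n⇒m≤1+n i≤m)))

  conv-congˡ : ∀ {f f′} g m → (∀ i → f i ≃ f′ i) → conv f g m ≃ conv f′ g m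
  conv-congˡ g m p = conv-cong m (λ i _ → p i) (λ _ _ → refl)

  conv-congʳ : ∀ f {g g′} m → (∀ i → i ≤ m → g i ≃ g′ i) → conv f g m ≃ conv f g′ m
  conv-congʳ f m = conv-cong m (λ _ _ → refl)

  conv-vanishˡ : ∀ {f} g m → (∀ i → f i ≃ 0#) → conv f g m ≃ 0#
  conv-vanishˡ g zero p = trans (*-congʳ (p 0)) (zeroˡ _)
  conv-vanishˡ g (suc m) p =
    trans (+-cong (trans (*-congʳ (p 0)) (zeroˡ _)) (conv-vanishˡ g m (λ i → p (suc i)))) (+-identityˡ _)

  conv-⊞ˡ : ∀ f f′ g m → conv (f ⊞ f′) g m ≃ conv f g m + conv f′ g m
  conv-⊞ˡ f f′ g zero = distribʳ _ _ _
  conv-⊞ˡ f f′ g (suc m) = trans (+-congˡ (conv-⊞ˡ (f ∘ suc) (f′ ∘ suc) g m))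
    (solve 5 (λ a b x u v → (a :+ b) :* x :+ (u :+ v) := (a :* x :+ u) :+ (b :* x :+ v)) refl _ _ _ _ _)

  conv-⊞ʳ : ∀ f g g′ m → conv f (g ⊞ g′) m ≃ conv f g m + conv f g′ m
  conv-⊞ʳ f g g′ zero = distribˡ _ _ _
  conv-⊞ʳ f g g′ (suc m) = trans (+-congˡ (conv-⊞ʳ (f ∘ suc) g g′ m))
    (solve 5 (λ a x y u v → a :* (x :+ y) :+ (u :+ v) := (a :* x :+ u) :+ (a :* y :+ v)) refl _ _ _ _ _)

  conv-·ˡ : ∀ a f g m → conv (a · f) g m ≃ a * conv f g m
  conv-·ˡ a f g zero = *-assoc _ _ _
  conv-·ˡ a f g (suc m) = trans (+-congˡ (conv-·ˡ a (f ∘ suc) g m))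
    (solve 4 (λ a x y u → (a :* x) :* y :+ a :* u := a :* (x :* y :+ u)) refl _ _ _ _)

  conv-·ʳ : ∀ a f g m → conv f (a · g) m ≃ a * conv f g m
  conv-·ʳ a f g zero = solve 3 (λ a x y → x :* (a :* y) := a :* (x :* y)) refl _ _ _
  conv-·ʳ a f g (suc m) = trans (+-congˡ (conv-·ʳ a (f ∘ suc) g m))
    (solve 4 (λ a x y u → x :* (a :* y) :+ a :* u := a :* (x :* y :+ u)) refl _ _ _ _)

  conv-identityˡ : ∀ g m → conv δ g m ≃ g m
  conv-identityˡ g zero = *-identityˡ _
  conv-identityˡ g (suc m) =
    trans (+-cong (*-identityˡ _) (conv-vanishˡ g m (λ _ → refl))) (+-identityʳ _)

  conv-sucʳ : ∀ f g m → conv f g (suc m) ≃ conv f (g ∘ suc) m + f (suc m) * g 0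
  conv-sucʳ f g zero = refl
  conv-sucʳ f g (suc m) = trans (+-congˡ (conv-sucʳ (f ∘ suc) g m)) (sym (+-assoc _ _ _))

  conv-comm : ∀ f g m → conv f g m ≃ conv g f m
  conv-comm f g zero = *-comm _ _
  conv-comm f g (suc m) = begin
    f 0 * g (suc m) + conv (f ∘ suc) g m  ≈⟨ +-cong (*-comm _ _) (conv-comm (f ∘ suc) g m) ⟩
    g (suc m) * f 0 + conv g (f ∘ suc) m  ≈⟨ +-comm _ _ ⟩
    conv g (f ∘ suc) m + g (suc m) * f 0  ≈⟨ conv-sucʳ g f m ⟨
    conv g f (suc m)                      ∎

  conv-assoc : ∀ f g k m → conv (conv f g) k m ≃ conv f (conv g k) m
  conv-assoc f g k zero = *-assoc _ _ _
  conv-assoc f g k (suc m) = begin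
    f 0 * g 0 * k (suc m) + conv (f 0 · (g ∘ suc) ⊞ conv (f ∘ suc) g) k m
      ≈⟨ +-congˡ (trans (conv-⊞ˡ _ _ k m) (+-cong (conv-·ˡ _ _ k m) (conv-assoc (f ∘ suc) g k m))) ⟩
    f 0 * g 0 * k (suc m) + (f 0 * conv (g ∘ suc) k m + conv (f ∘ suc) (conv g k) m)
      ≈⟨ solve 5 (λ a b x u v → a :* b :* x :+ (a :* u :+ v) := a :* (b :* x :+ u) :+ v) refl _ _ _ _ _ ⟩
    f 0 * conv g k (suc m) + conv (f ∘ suc) (conv g k) m ∎

  conv-swap : ∀ f g k m → conv f (conv g k) m ≃ conv g (conv f k) m
  conv-swap f g k m = begin
    conv f (conv g k) m  ≈⟨ conv-assoc f g k m ⟨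
    conv (conv f g) k m  ≈⟨ conv-congˡ k m (conv-comm f g) ⟩
    conv (conv g f) k m  ≈⟨ conv-assoc g f k m ⟩
    conv g (conv f k) m  ∎

  ι : ℕ → A
  ι zero = 0#
  ι (suc k) = 1# + ι k

  -- The operator t d/dt on generating functions; `D-conv` is its Leibniz rule.
  D : (ℕ → A) → ℕ → A
  D f k = ι k * f k

  D-conv : ∀ f g m → D (conv f g) m ≃ conv (D f) g m + conv f (D g) m
  D-conv f g zero = solve 2 (λ x y → con 0 :* (x :* y) := con 0 :* x :* y :+ x :* (con 0 :* y)) refl _ _
  D-conv f g (suc m) = begin
    ι (suc m) * (f 0 * g (suc m) + conv (f ∘ suc) g m)
      ≈⟨ solve 4 (λ n x y u → (con 1 :+ n) :* (x :* y :+ u)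
                   := (x :* ((con 1 :+ n) :* y) :+ (n :* u :+ u))) refl _ _ _ _ ⟩
    f 0 * D g (suc m) + (D (conv (f ∘ suc) g) m + conv (f ∘ suc) g m)
      ≈⟨ +-congˡ (+-congʳ (D-conv (f ∘ suc) g m)) ⟩
    f 0 * D g (suc m) + (conv (D (f ∘ suc)) g m + conv (f ∘ suc) (D g) m + conv (f ∘ suc) g m)
      ≈⟨ solve 6 (λ p a b c x y → p :+ (a :+ b :+ c) := (con 0 :* x :* y :+ (c :+ a)) :+ (p :+ b)) refl _ _ _ _ (f 0) (g (suc m)) ⟩
    (D f 0 * g (suc m) + (conv (f ∘ suc) g m + conv (D (f ∘ suc)) g m)) + (f 0 * D g (suc m) + conv (f ∘ suc) (D g) m)
      ≈⟨ +-congʳ (+-congˡ (trans (sym (conv-⊞ˡ _ _ g m))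
           (conv-congˡ g m λ i → solve 2 (λ n x → x :+ n :* x := (con 1 :+ n) :* x) refl _ _))) ⟩
    conv (D f) g (suc m) + conv f (D g) (suc m) ∎

  -- The exponential formula's recursion k x_k = Σ_{i=1}^k p_i x_{k-i}, with p shifted by one.
  Newton : (ℕ → A) → (ℕ → A) → Set ℓ
  Newton p x = ∀ k → D x (suc k) ≃ conv p x k

  -- The recursion says that `p` is the logarithmic derivative of `x`, and the logarithmic
  -- derivatives of two factors add.
  Newton-conv : ∀ {p p′ x x′} → Newton p x → Newton p′ x′ → Newton (p ⊞ p′) (conv x x′)
  Newton-conv {p} {p′} {x} {x′} N N′ k = begin
    D (conv x x′) (suc k)
      ≈⟨ D-conv x x′ (suc k) ⟩
    conv (D x) x′ (suc k) + conv x (D x′) (suc k)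
      ≈⟨ +-cong (part x x′ N) (trans (conv-comm x (D x′) (suc k)) (part x′ x N′)) ⟩
    conv p (conv x x′) k + conv p′ (conv x′ x) k
      ≈⟨ +-congˡ (conv-congʳ p′ k λ i _ → conv-comm x′ x i) ⟩
    conv p (conv x x′) k + conv p′ (conv x x′) k
      ≈⟨ conv-⊞ˡ p p′ _ k ⟨
    conv (p ⊞ p′) (conv x x′) k ∎
    where
    part : ∀ {p} x x′ → Newton p x → conv (D x) x′ (suc k) ≃ conv p (conv x x′) k
    part {p} x x′ N = begin
      0# * x 0 * x′ (suc k) + conv (D x ∘ suc) x′ k
        ≈⟨ solve 3 (λ a b u → con 0 :* a :* b :+ u := u) refl _ _ _ ⟩
      conv (D x ∘ suc) x′ k  ≈⟨ conv-congˡ x′ k N ⟩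
      conv (conv p x) x′ k   ≈⟨ conv-assoc p x x′ k ⟩
      conv p (conv x x′) k   ∎

  -- Division by k + 1, supplied by `r`, lets the recursion determine each value from the earlier
  -- ones.
  Newton-unique : (r : ℕ → A) → (∀ k → r k * ι (suc k) ≃ 1#) → ∀ {p x y} →
                  Newton p x → Newton p y → x 0 ≃ y 0 → ∀ k → x k ≃ y k
  Newton-unique r r-inv {p} {x} {y} N N′ x₀≃y₀ k = below k k ℕₚ.≤-refl
    where
    cancel : ∀ k {a} → r k * (ι (suc k) * a) ≃ a
    cancel k {a} = trans (sym (*-assoc _ _ _)) (trans (*-congʳ (r-inv k)) (*-identityˡ a))

    below : ∀ n k → k ≤ n → x k ≃ y k
    below _ zero _ = x₀≃y₀
    below (suc n) (suc k) (s≤s k≤n) = begin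
      x (suc k)            ≈⟨ cancel k ⟨
      r k * D x (suc k)    ≈⟨ *-congˡ (N k) ⟩
      r k * conv p x k     ≈⟨ *-congˡ (conv-congʳ p k λ i i≤k → below n i (ℕₚ.≤-trans i≤k k≤n)) ⟩
      r k * conv p y k     ≈⟨ *-congˡ (N′ k) ⟨
      r k * D y (suc k)    ≈⟨ cancel k ⟩
      y (suc k)            ∎

  -- Equality of the two weighted counts, for arbitrary odd and even weights

  module BracketedPaths (O E : ℕ → A) (O₀ : O 0 ≃ 0#) (E₀ : E 0 ≃ 0#) (E₁ : E 1 ≃ 0#) where

    two : A
    two = 1# + 1#

    truncate : ℕ → (ℕ → A) → ℕ → A
    truncate n f m = if m ≤ᵇ n then f m else 0#

    truncate-≤ : ∀ {n m} f → m ≤ n → truncate n f m ≡ f m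
    truncate-≤ {n} {m} f m≤n with m ≤ᵇ n | ℕₚ.≤⇒≤ᵇ m≤n
    ... | true | _ = ≡.refl

    truncate-> : ∀ {n m} f → n < m → truncate n f m ≡ 0#
    truncate-> {n} {m} f n<m with m ≤ᵇ n | ℕₚ.≤ᵇ⇒≤ m n
    ... | false | _ = ≡.refl
    ... | true | m≤n with () ← ℕₚ.<⇒≱ n<m (m≤n _)

    -- The share moved to a closing spot may be empty: in the sum defining R_2m the second index
    -- goes down to 0, while the first one stays positive.
    U : ℕ → A
    U = δ ⊞ E

    -- Later identified with sh(h_k), which is 1 for k = 0 and 2 P_k otherwise.
    q : ℕ → A
    q = δ ⊞ (two · O ⊞ two · E)

    -- The sign of an outermost bracket is free; an inner bracket inherits it.
    opening : ℕ → A
    opening zero = two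
    opening (suc _) = 1#

    -- F n m and G n d m are the total weights of all ways to assign m cars to the last n spots, for
    -- the left and the right hand side of the theorem; d is the number of open brackets.
    F : ℕ → ℕ → A
    F zero = δ
    F (suc n) = truncate (suc n) (conv q (F n))

    G : ℕ → ℕ → ℕ → A
    Gstep : ℕ → ℕ → ℕ → A
    G zero d = δ
    G (suc n) d = truncate (suc n) (Gstep n d)
    -- The summands treat the first spot as empty, odd or even. `ℕ.pred` keeps depth 0 at an empty
    -- spot that closes nothing.
    Gstep n d = G n (ℕ.pred d) ⊞ (conv (two · O) (G n d) ⊞ opening d · conv (conv E U) (G n (suc d)))

    F-high : ∀ n {m} → n < m → F n m ≃ 0#
    F-high zero (s≤s _) = refl
    F-high (suc n) n<m = reflexive (truncate-> (conv q (F n)) n<m)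

    G-high : ∀ n d {m} → n < m → G n d m ≃ 0#
    G-high zero d (s≤s _) = refl
    G-high (suc n) d n<m = reflexive (truncate-> (Gstep n d) n<m)

    -- Each factor U distributes the part of an opening's cars that moves to its closing spot.
    pending : ℕ → (ℕ → A) → ℕ → A
    pending zero f = f
    pending (suc d) f = conv U (pending d f)

    pending-cong : ∀ d {f g} m → (∀ i → i ≤ m → f i ≃ g i) → pending d f m ≃ pending d g m
    pending-cong zero m p = p m ℕₚ.≤-refl
    pending-cong (suc d) m p =
      conv-congʳ U m λ i i≤m → pending-cong d i λ j j≤i → p j (ℕₚ.≤-trans j≤i i≤m)

    pending-⊞ : ∀ d f g m → pending d (f ⊞ g) m ≃ pending d f m + pending d g m
    pending-⊞ zero f g m = refl
    pending-⊞ (suc d) f g m = trans (conv-congʳ U m λ i _ → pending-⊞ d f g i) (conv-⊞ʳ U _ _ m)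

    pending-· : ∀ d a f m → pending d (a · f) m ≃ a * pending d f m
    pending-· zero a f m = refl
    pending-· (suc d) a f m = trans (conv-congʳ U m λ i _ → pending-· d a f i) (conv-·ʳ a U _ m)

    -- Filling a spot and setting shares aside are both convolutions, so they can be exchanged.
    pending-conv : ∀ d f g m → pending d (conv f g) m ≃ conv f (pending d g) m
    pending-conv zero f g m = refl
    pending-conv (suc d) f g m =
      trans (conv-congʳ U m λ i _ → pending-conv d f g i) (conv-swap U f (pending d g) m)

    vanishing : ∀ {e} → e ≃ 0# → ∀ {a b} → e * a ≃ e * b
    vanishing e≃0 = trans (trans (*-congʳ e≃0) (zeroˡ _)) (sym (trans (*-congʳ e≃0) (zeroˡ _)))

    -- An odd spot takes at least one car, so only values at smaller arguments enter.
    conv-O : ∀ {f g} m → (∀ i → suc i ≤ m → f i ≃ g i) → conv (two · O) f m ≃ conv (two · O) g m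
    conv-O zero p = vanishing (trans (*-congˡ O₀) (zeroʳ two))
    conv-O (suc m) p = +-cong (vanishing (trans (*-congˡ O₀) (zeroʳ two)))
                              (conv-congʳ _ m λ i i≤m → p i (s≤s i≤m))

    -- An even opening takes at least two cars; the second one pays for the increased depth in the
    -- bound of `pending-G`.
    conv-E : ∀ {f g} m → (∀ i → suc (suc i) ≤ m → f i ≃ g i) → conv E f m ≃ conv E g m
    conv-E zero p = vanishing E₀
    conv-E (suc zero) p = +-cong (vanishing E₀) (vanishing E₁)
    conv-E (suc (suc m)) p =
      +-cong (vanishing E₀) (+-cong (vanishing E₁) (conv-congʳ _ m λ i i≤m → p i (s≤s (s≤s i≤m))))

    conv-U : ∀ f m → conv U f m ≃ f m + conv E f m
    conv-U f m = trans (conv-⊞ˡ δ E f m) (+-congʳ (conv-identityˡ f m))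

    conv-q : ∀ f m → conv q f m ≃ f m + (conv (two · O) f m + two * conv E f m)
    conv-q f m = trans (conv-⊞ˡ δ _ f m) (+-cong (conv-identityˡ f m)
      (trans (conv-⊞ˡ _ _ f m) (+-congˡ (conv-·ˡ two E f m))))

    -- A new opening keeps the `E`-part of `conv E U` and defers the `U`-part, which turns
    -- `pending d` into `pending (suc d)`.
    pending-Gstep : ∀ n d m → pending d (Gstep n d) m ≃
      pending d (G n (ℕ.pred d)) m +
        (conv (two · O) (pending d (G n d)) m + opening d * conv E (pending (suc d) (G n (suc d))) m)
    pending-Gstep n d m = trans (pending-⊞ d _ _ m) (+-congˡ (trans (pending-⊞ d _ _ m)
      (+-cong (pending-conv d _ _ m) (trans (pending-· d _ _ m) (*-congˡ evens)))))
      where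
      evens : pending d (conv (conv E U) (G n (suc d))) m ≃ conv E (pending (suc d) (G n (suc d))) m
      evens = trans (pending-conv d _ _ m) (conv-assoc E U _ m)

    -- The odd and even terms follow by induction, their cars keeping the bound intact; the balance
    -- between closings and openings is left to `closing`.
    pending-G : ∀ n d m → m ℕ.+ d ≤ n → pending d (G n d) m ≃ F n m
    -- Each even spot must count twice. At depth 0 the two signs of an opening do this. At positive
    -- depth one copy is the opening, and the other is the `E` in the factor `U` = `δ ⊞ E` of a
    -- closing spot.
    closing : ∀ n d m → m ℕ.+ d ≤ suc n →
      pending d (G n (ℕ.pred d)) m + opening d * conv E (F n) m ≃ F n m + two * conv E (F n) m

    pending-G zero zero m _ = refl
    -- No bracket can still be open once the spots are used up.
    pending-G zero (suc d) m m+d≤n with () ← ℕₚ.≤-trans (ℕₚ.m≤n+m (suc d) m) m+d≤n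
    pending-G (suc n) d m m+d≤n = begin
      pending d (G (suc n) d) m
        -- Setting shares aside only lowers the number of cars, so the truncation of `G` has no
        -- effect here.
        ≈⟨ pending-cong d m (λ i i≤m → reflexive (truncate-≤ (Gstep n d) (ℕₚ.≤-trans i≤m m≤n))) ⟩
      pending d (Gstep n d) m
        ≈⟨ pending-Gstep n d m ⟩
      pending d (G n (ℕ.pred d)) m +
        (conv (two · O) (pending d (G n d)) m + opening d * conv E (pending (suc d) (G n (suc d))) m)
        ≈⟨ +-congˡ (+-cong (conv-O m λ i i<m → pending-G n d i (odd-bound i<m))
                           (*-congˡ (conv-E m λ i i<m → pending-G n (suc d) i (even-bound i<m)))) ⟩
      pending d (G n (ℕ.pred d)) m + (conv (two · O) (F n) m + opening d * conv E (F n) m)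
        ≈⟨ solve 3 (λ a b c → a :+ (b :+ c) := b :+ (a :+ c)) refl _ _ _ ⟩
      conv (two · O) (F n) m + (pending d (G n (ℕ.pred d)) m + opening d * conv E (F n) m)
        ≈⟨ +-congˡ (closing n d m m+d≤n) ⟩
      conv (two · O) (F n) m + (F n m + two * conv E (F n) m)
        ≈⟨ solve 3 (λ a b c → b :+ (a :+ c) := a :+ (b :+ c)) refl _ _ _ ⟩
      F n m + (conv (two · O) (F n) m + two * conv E (F n) m)
        ≈⟨ conv-q (F n) m ⟨
      conv q (F n) m
        ≡⟨ truncate-≤ (conv q (F n)) m≤n ⟨
      F (suc n) m ∎
      where
      m≤n : m ≤ suc n
      m≤n = ℕₚ.≤-trans (ℕₚ.m≤m+n m d) m+d≤n
      odd-bound : ∀ {i} → suc i ≤ m → i ℕ.+ d ≤ n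
      odd-bound i<m = ℕₚ.≤-pred (ℕₚ.≤-trans (ℕₚ.+-monoˡ-≤ d i<m) m+d≤n)
      even-bound : ∀ {i} → suc (suc i) ≤ m → i ℕ.+ suc d ≤ n
      even-bound {i} i<m rewrite ℕₚ.+-suc i d = odd-bound i<m

    closing n zero m m+d≤n with ℕₚ.m≤n⇒m<n∨m≡n m+d≤n
    ... | inj₁ (s≤s m≤n) = +-congʳ (pending-G n 0 m m≤n)
    -- An empty spot at depth 0 with n + 1 cars for `n` spots: both totals vanish by truncation.
    ... | inj₂ m+0≡1+n = +-congʳ (trans (G-high n 0 n<m) (sym (F-high n n<m)))
      where
      n<m : n < m
      n<m = ℕₚ.≤-reflexive (≡.sym (≡.trans (≡.sym (ℕₚ.+-identityʳ m)) m+0≡1+n))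
    closing n (suc d) m m+d≤n = begin
      conv U (pending d (G n d)) m + 1# * conv E (F n) m
        ≈⟨ +-congʳ (conv-congʳ U m λ i i≤m → pending-G n d i (bound i≤m)) ⟩
      conv U (F n) m + 1# * conv E (F n) m
        ≈⟨ +-congʳ (conv-U (F n) m) ⟩
      F n m + conv E (F n) m + 1# * conv E (F n) m
        ≈⟨ solve 2 (λ a b → a :+ b :+ con 1 :* b := a :+ con 2 :* b) refl _ _ ⟩
      F n m + two * conv E (F n) m ∎
      where
      bound : ∀ {i} → i ≤ m → i ℕ.+ d ≤ n
      bound {i} i≤m = ℕₚ.≤-pred (ℕₚ.≤-trans (ℕₚ.≤-reflexive (≡.sym (ℕₚ.+-suc i d)))
        (ℕₚ.≤-trans (ℕₚ.+-monoˡ-≤ (suc d) i≤m) m+d≤n))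

    G≃F : ∀ n → G n 0 n ≃ F n n
    G≃F n = pending-G n 0 n (ℕₚ.≤-reflexive (ℕₚ.+-identityʳ n))

-- Sym_ℚ as a commutative semiring

insert-≤ : ∀ {x y} ys → x ≤ y → insert x (y ∷ ys) ≡ x ∷ y ∷ ys
insert-≤ {x} {y} ys x≤y with x ≤ᵇ y | ℕₚ.≤⇒≤ᵇ x≤y
... | true | _ = ≡.refl

insert-> : ∀ {x y} ys → y < x → insert x (y ∷ ys) ≡ y ∷ insert x ys
insert-> {x} {y} ys y<x with x ≤ᵇ y | ℕₚ.≤ᵇ⇒≤ x y
... | false | _ = ≡.refl
... | true | x≤y with () ← ℕₚ.<⇒≱ y<x (x≤y _)

insert-comm-< : ∀ {x y} → x < y → ∀ zs → insert x (insert y zs) ≡ insert y (insert x zs)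
insert-comm-< x<y [] = ≡.trans (insert-≤ [] (ℕₚ.<⇒≤ x<y)) (≡.sym (insert-> [] x<y))
insert-comm-< {x} {y} x<y (z ∷ zs) with ℕₚ.≤-<-connex y z
... | inj₁ y≤z
  rewrite insert-≤ zs y≤z | insert-≤ (z ∷ zs) (ℕₚ.<⇒≤ x<y) | insert-≤ zs (ℕₚ.≤-trans (ℕₚ.<⇒≤ x<y) y≤z)
        | insert-> (z ∷ zs) x<y | insert-≤ zs y≤z = ≡.refl
... | inj₂ z<y with ℕₚ.≤-<-connex x z
...   | inj₁ x≤z
  rewrite insert-> zs z<y | insert-≤ (insert y zs) x≤z | insert-≤ zs x≤z
        | insert-> (z ∷ zs) x<y | insert-> zs z<y = ≡.refl
...   | inj₂ z<x
  rewrite insert-> zs z<y | insert-> (insert y zs) z<x | insert-> zs z<x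
        | insert-> (insert x zs) z<y = cong (z ∷_) (insert-comm-< x<y zs)

insert-comm : ∀ x y zs → insert x (insert y zs) ≡ insert y (insert x zs)
insert-comm x y zs with ℕₚ.<-cmp x y
... | tri< x<y _ _ = insert-comm-< x<y zs
... | tri≈ _ ≡.refl _ = ≡.refl
... | tri> _ _ y<x = ≡.sym (insert-comm-< y<x zs)

-- Makes the indicator of a sorted monomial a symmetric functional, as `≋⇒≈` requires.
sort-↭ : ∀ {xs ys} → xs ↭ ys → sort xs ≡ sort ys
sort-↭ ↭.refl = ≡.refl
sort-↭ (↭.prep x p) = cong (insert x) (sort-↭ p)
sort-↭ {ys = _ ∷ _ ∷ ys} (↭.swap x y p) =
  ≡.trans (cong (λ l → insert x (insert y l)) (sort-↭ p)) (insert-comm x y (sort ys))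
sort-↭ (↭.trans p p′) = ≡.trans (sort-↭ p) (sort-↭ p′)

module ℚ+ = CommSemigroup (CommutativeMonoid.commutativeSemigroup ℚₚ.+-0-commutativeMonoid)
module ℚ* = CommSemigroup (CommutativeMonoid.commutativeSemigroup ℚₚ.*-1-commutativeMonoid)

-- Linear functionals on formal combinations of monomials

Functional : Set
Functional = List ℕ → ℚ

Symmetric : Functional → Set
Symmetric φ = ∀ {s t} → s ↭ t → φ s ≡ φ t

eval : Functional → Sym → ℚ
eval φ [] = 0ℚ
eval φ ((c , s) ∷ f) = c ℚ.* φ s ℚ.+ eval φ f

eval-cong : ∀ {φ ψ} → (∀ s → φ s ≡ ψ s) → ∀ f → eval φ f ≡ eval ψ f
eval-cong φ≡ψ [] = ≡.refl
eval-cong φ≡ψ ((c , s) ∷ f) = cong₂ (λ a b → c ℚ.* a ℚ.+ b) (φ≡ψ s) (eval-cong φ≡ψ f)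

eval-++ : ∀ φ f g → eval φ (f ++ g) ≡ eval φ f ℚ.+ eval φ g
eval-++ φ [] g = ≡.sym (ℚₚ.+-identityˡ _)
eval-++ φ ((c , s) ∷ f) g = ≡.trans (cong (c ℚ.* φ s ℚ.+_) (eval-++ φ f g)) (≡.sym (ℚₚ.+-assoc (c ℚ.* φ s) (eval φ f) (eval φ g)))

eval-0 : ∀ f → eval (λ _ → 0ℚ) f ≡ 0ℚ
eval-0 [] = ≡.refl
eval-0 ((c , s) ∷ f) = ≡.trans (cong₂ ℚ._+_ (ℚₚ.*-zeroʳ c) (eval-0 f)) (ℚₚ.+-identityˡ 0ℚ)

eval-+ : ∀ φ ψ f → eval (λ s → φ s ℚ.+ ψ s) f ≡ eval φ f ℚ.+ eval ψ f
eval-+ φ ψ [] = ≡.sym (ℚₚ.+-identityˡ 0ℚ)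
eval-+ φ ψ ((c , s) ∷ f) =
  ≡.trans (cong₂ ℚ._+_ (ℚₚ.*-distribˡ-+ c (φ s) (ψ s)) (eval-+ φ ψ f)) (ℚ+.interchange (c ℚ.* φ s) (c ℚ.* ψ s) (eval φ f) (eval ψ f))

eval-* : ∀ a φ f → eval (λ s → a ℚ.* φ s) f ≡ a ℚ.* eval φ f
eval-* a φ [] = ≡.sym (ℚₚ.*-zeroʳ a)
eval-* a φ ((c , s) ∷ f) =
  ≡.trans (cong₂ ℚ._+_ (ℚ*.x∙yz≈y∙xz c a (φ s)) (eval-* a φ f)) (≡.sym (ℚₚ.*-distribˡ-+ a _ _))

-- Fubini for finite sums; commutativity of `_⊗_` rests on it.
eval-swap : ∀ (Φ : List ℕ → List ℕ → ℚ) f g →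
            eval (λ s → eval (Φ s) g) f ≡ eval (λ t → eval (λ s → Φ s t) f) g
eval-swap Φ [] g = ≡.sym (eval-0 g)
eval-swap Φ ((c , s) ∷ f) g = begin
  c ℚ.* eval (Φ s) g ℚ.+ eval (λ s → eval (Φ s) g) f
    ≡⟨ cong₂ ℚ._+_ (≡.sym (eval-* c (Φ s) g)) (eval-swap Φ f g) ⟩
  eval (λ t → c ℚ.* Φ s t) g ℚ.+ eval (λ t → eval (λ s → Φ s t) f) g
    ≡⟨ eval-+ _ _ g ⟨
  eval (λ t → c ℚ.* Φ s t ℚ.+ eval (λ s → Φ s t) f) g ∎
  where open ≡-Reasoning

eval-⊗ : ∀ φ f g → eval φ (f ⊗ g) ≡ eval (λ s → eval (λ t → φ (s ++ t)) g) f
eval-⊗ φ [] g = ≡.refl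
eval-⊗ φ ((c , s) ∷ f) g = ≡.trans (eval-++ φ (map _ g) _) (cong₂ ℚ._+_ (term g) (eval-⊗ φ f g))
  where
  term : ∀ g → eval φ (map (λ t → (c ℚ.* proj₁ t , s ++ proj₂ t)) g) ≡ c ℚ.* eval (λ t → φ (s ++ t)) g
  term [] = ≡.sym (ℚₚ.*-zeroʳ c)
  term ((b , t) ∷ g) = ≡.trans (cong₂ ℚ._+_ (ℚₚ.*-assoc c b _) (term g)) (≡.sym (ℚₚ.*-distribˡ-+ c _ _))

eval-⊙ : ∀ φ a f → eval φ (a ⊙ f) ≡ a ℚ.* eval φ f
eval-⊙ φ a [] = ≡.sym (ℚₚ.*-zeroʳ a)
eval-⊙ φ a ((c , s) ∷ f) =
  ≡.trans (cong₂ ℚ._+_ (ℚₚ.*-assoc a c _) (eval-⊙ φ a f)) (≡.sym (ℚₚ.*-distribˡ-+ a _ _))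

shProduct : List ℕ → ℚ
shProduct s = foldr ℚ._*_ 1ℚ (map shFactor s)

-- `sh` is diagonal in the power-sum basis, so its transpose multiplies a functional by `shProduct`.
eval-sh : ∀ φ f → eval φ (sh f) ≡ eval (λ s → shProduct s ℚ.* φ s) f
eval-sh φ [] = ≡.refl
eval-sh φ ((c , s) ∷ f) = cong₂ ℚ._+_ (ℚₚ.*-assoc c _ _) (eval-sh φ f)

shProduct-++ : ∀ s t → shProduct (s ++ t) ≡ shProduct s ℚ.* shProduct t
shProduct-++ [] t = ≡.sym (ℚₚ.*-identityˡ _)
shProduct-++ (x ∷ s) t =
  ≡.trans (cong (shFactor x ℚ.*_) (shProduct-++ s t)) (≡.sym (ℚₚ.*-assoc (shFactor x) _ _))

shProduct-symmetric : Symmetric shProduct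
shProduct-symmetric ↭.refl = ≡.refl
shProduct-symmetric (↭.prep x p) = cong (shFactor x ℚ.*_) (shProduct-symmetric p)
shProduct-symmetric (↭.swap x y p) =
  ≡.trans (cong (λ a → shFactor x ℚ.* (shFactor y ℚ.* a)) (shProduct-symmetric p))
          (ℚ*.x∙yz≈y∙xz (shFactor x) (shFactor y) _)
shProduct-symmetric (↭.trans p p′) = ≡.trans (shProduct-symmetric p) (shProduct-symmetric p′)

-- Equality in Sym_ℚ tested against all linear functionals on commutative monomials; products and
-- sh then respect it because they transpose to operations on functionals.
infix 4 _≋_
record _≋_ (f g : Sym) : Set where
  constructor equal
  field evals : ∀ φ → Symmetric φ → eval φ f ≡ eval φ g
open _≋_

coeff-eval : ∀ μ f → coeff μ f ≡ eval (λ s → if eqℕs (sort s) (sort μ) then 1ℚ else 0ℚ) f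
coeff-eval μ [] = ≡.refl
coeff-eval μ ((c , s) ∷ f) with eqℕs (sort s) (sort μ)
... | true = cong₂ ℚ._+_ (≡.sym (ℚₚ.*-identityʳ c)) (coeff-eval μ f)
... | false = ≡.trans (coeff-eval μ f)
                (≡.sym (≡.trans (cong (ℚ._+ _) (ℚₚ.*-zeroʳ c)) (ℚₚ.+-identityˡ _)))

≋⇒≈ : ∀ {f g} → f ≋ g → f ≈ g
≋⇒≈ {f} {g} f≋g μ = begin
  coeff μ f  ≡⟨ coeff-eval μ f ⟩
  _          ≡⟨ evals f≋g _ (λ p → cong (λ s → if eqℕs s (sort μ) then 1ℚ else 0ℚ) (sort-↭ p)) ⟩
  _          ≡⟨ coeff-eval μ g ⟨
  coeff μ g  ∎
  where open ≡-Reasoning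

⊕-cong : ∀ {f f′ g g′} → f ≋ f′ → g ≋ g′ → f ⊕ g ≋ f′ ⊕ g′
⊕-cong {f} {f′} p q = equal λ φ S → ≡.trans (eval-++ φ f _)
  (≡.trans (cong₂ ℚ._+_ (evals p φ S) (evals q φ S)) (≡.sym (eval-++ φ f′ _)))

⊕-comm : ∀ f g → f ⊕ g ≋ g ⊕ f
⊕-comm f g = equal λ φ _ →
  ≡.trans (eval-++ φ f g) (≡.trans (ℚₚ.+-comm (eval φ f) (eval φ g)) (≡.sym (eval-++ φ g f)))

⊗-cong : ∀ {f f′ g g′} → f ≋ f′ → g ≋ g′ → f ⊗ g ≋ f′ ⊗ g′
⊗-cong {f} {f′} {g} {g′} p q = equal λ φ S → begin
  eval φ (f ⊗ g)
    ≡⟨ eval-⊗ φ f g ⟩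
  eval (λ s → eval (λ t → φ (s ++ t)) g) f
    ≡⟨ eval-cong (λ s → evals q _ (λ t↭t′ → S (↭ₚ.++⁺ˡ s t↭t′))) f ⟩
  eval (λ s → eval (λ t → φ (s ++ t)) g′) f
    ≡⟨ evals p _ (λ s↭s′ → eval-cong (λ t → S (↭ₚ.++⁺ʳ t s↭s′)) g′) ⟩
  eval (λ s → eval (λ t → φ (s ++ t)) g′) f′
    ≡⟨ eval-⊗ φ f′ g′ ⟨
  eval φ (f′ ⊗ g′) ∎
  where open ≡-Reasoning

⊗-comm : ∀ f g → f ⊗ g ≋ g ⊗ f
⊗-comm f g = equal λ φ S → begin
  eval φ (f ⊗ g)                             ≡⟨ eval-⊗ φ f g ⟩
  eval (λ s → eval (λ t → φ (s ++ t)) g) f   ≡⟨ eval-swap _ f g ⟩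
  eval (λ t → eval (λ s → φ (s ++ t)) f) g   ≡⟨ eval-cong (λ t → eval-cong (λ s → S (↭ₚ.++-comm s t)) f) g ⟩
  eval (λ t → eval (λ s → φ (t ++ s)) f) g   ≡⟨ eval-⊗ φ g f ⟨
  eval φ (g ⊗ f)                             ∎
  where open ≡-Reasoning

⊗-assoc : ∀ f g k → (f ⊗ g) ⊗ k ≋ f ⊗ (g ⊗ k)
⊗-assoc f g k = equal λ φ S → begin
  eval φ ((f ⊗ g) ⊗ k)
    ≡⟨ eval-⊗ φ (f ⊗ g) k ⟩
  eval (λ s → eval (λ u → φ (s ++ u)) k) (f ⊗ g)
    ≡⟨ eval-⊗ _ f g ⟩
  eval (λ s → eval (λ t → eval (λ u → φ ((s ++ t) ++ u)) k) g) f
    ≡⟨ eval-cong (λ s → eval-cong (λ t → eval-cong (λ u → cong φ (Listₚ.++-assoc s t u)) k) g) f ⟩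
  eval (λ s → eval (λ t → eval (λ u → φ (s ++ (t ++ u))) k) g) f
    ≡⟨ eval-cong (λ s → eval-⊗ _ g k) f ⟨
  eval (λ s → eval (λ v → φ (s ++ v)) (g ⊗ k)) f
    ≡⟨ eval-⊗ φ f (g ⊗ k) ⟨
  eval φ (f ⊗ (g ⊗ k)) ∎
  where open ≡-Reasoning

constant : ℚ → Sym
constant a = [ (a , []) ]

constant-⊗ : ∀ a f → constant a ⊗ f ≋ a ⊙ f
constant-⊗ a f = equal λ φ _ →
  ≡.trans (eval-⊗ φ (constant a) f) (≡.trans (ℚₚ.+-identityʳ _) (≡.sym (eval-⊙ φ a f)))

⊗-identityˡ : ∀ f → 𝟙 ⊗ f ≋ f
⊗-identityˡ f = equal λ φ _ →
  ≡.trans (eval-⊗ φ 𝟙 f) (≡.trans (ℚₚ.+-identityʳ _) (ℚₚ.*-identityˡ _))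

⊗-distribʳ-⊕ : ∀ f g k → (g ⊕ k) ⊗ f ≋ (g ⊗ f) ⊕ (k ⊗ f)
⊗-distribʳ-⊕ f g k = equal λ φ _ → begin
  eval φ ((g ⊕ k) ⊗ f)                   ≡⟨ eval-⊗ φ (g ⊕ k) f ⟩
  _                                      ≡⟨ eval-++ _ g k ⟩
  _                                      ≡⟨ cong₂ ℚ._+_ (eval-⊗ φ g f) (eval-⊗ φ k f) ⟨
  eval φ (g ⊗ f) ℚ.+ eval φ (k ⊗ f)      ≡⟨ eval-++ φ (g ⊗ f) (k ⊗ f) ⟨
  eval φ ((g ⊗ f) ⊕ (k ⊗ f))             ∎
  where open ≡-Reasoning

≋-refl : ∀ {f} → f ≋ f
≋-refl = equal λ _ _ → ≡.refl

≋-sym : ∀ {f g} → f ≋ g → g ≋ f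
≋-sym p = equal λ φ S → ≡.sym (evals p φ S)

≋-trans : ∀ {f g k} → f ≋ g → g ≋ k → f ≋ k
≋-trans p q = equal λ φ S → ≡.trans (evals p φ S) (evals q φ S)

≋-reflexive : ∀ {f g} → f ≡ g → f ≋ g
≋-reflexive ≡.refl = ≋-refl

Sym-commutativeSemiring : CommutativeSemiring 0ℓ 0ℓ
Sym-commutativeSemiring = record
  { Carrier = Sym
  ; _≈_ = _≋_
  ; _+_ = _⊕_
  ; _*_ = _⊗_
  ; 0# = []
  ; 1# = 𝟙
  ; isCommutativeSemiring = isCommutativeSemiringˡ (record
    { +-isCommutativeMonoid = record
      { isMonoid = record
        { isSemigroup = record
          { isMagma = record { isEquivalence = isEq ; ∙-cong = ⊕-cong }
          ; assoc = λ f g k → ≋-reflexive (Listₚ.++-assoc f g k)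
          }
        ; identity = (λ _ → ≋-refl) , (λ f → ≋-reflexive (Listₚ.++-identityʳ f))
        }
      ; comm = ⊕-comm
      }
    ; *-isCommutativeMonoid = record
      { isMonoid = record
        { isSemigroup = record
          { isMagma = record { isEquivalence = isEq ; ∙-cong = ⊗-cong }
          ; assoc = ⊗-assoc
          }
        ; identity = ⊗-identityˡ , (λ f → ≋-trans (⊗-comm f 𝟙) (⊗-identityˡ f))
        }
      ; comm = ⊗-comm
      }
    ; distribʳ = ⊗-distribʳ-⊕
    ; zeroˡ = λ _ → ≋-refl
    })
  }
  where
  isEq : IsEquivalence _≋_
  isEq = record { refl = ≋-refl ; sym = ≋-sym ; trans = ≋-trans }

sh-cong : ∀ {f g} → f ≋ g → sh f ≋ sh g
sh-cong {f} {g} p = equal λ φ S → ≡.trans (eval-sh φ f)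
  (≡.trans (evals p _ λ q → cong₂ ℚ._*_ (shProduct-symmetric q) (S q)) (≡.sym (eval-sh φ g)))

sh-⊕ : ∀ f g → sh (f ⊕ g) ≡ sh f ⊕ sh g
sh-⊕ f g = Listₚ.map-++ _ f g

sh-⊗ : ∀ f g → sh (f ⊗ g) ≋ sh f ⊗ sh g
sh-⊗ f g = equal λ φ _ → begin
  eval φ (sh (f ⊗ g))
    ≡⟨ eval-sh φ (f ⊗ g) ⟩
  eval (λ s → shProduct s ℚ.* φ s) (f ⊗ g)
    ≡⟨ eval-⊗ _ f g ⟩
  eval (λ s → eval (λ t → shProduct (s ++ t) ℚ.* φ (s ++ t)) g) f
    ≡⟨ eval-cong (λ s → eval-cong (λ t → ≡.trans (cong (ℚ._* φ (s ++ t)) (shProduct-++ s t)) (ℚₚ.*-assoc (shProduct s) (shProduct t) (φ (s ++ t)))) g) f ⟩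
  eval (λ s → eval (λ t → shProduct s ℚ.* (shProduct t ℚ.* φ (s ++ t))) g) f
    ≡⟨ eval-cong (λ s → ≡.trans (eval-* (shProduct s) _ g) (cong (shProduct s ℚ.*_) (≡.sym (eval-sh _ g)))) f ⟩
  eval (λ s → shProduct s ℚ.* eval (λ t → φ (s ++ t)) (sh g)) f
    ≡⟨ eval-sh _ f ⟨
  eval (λ s → eval (λ t → φ (s ++ t)) (sh g)) (sh f)
    ≡⟨ eval-⊗ φ (sh f) (sh g) ⟨
  eval φ (sh f ⊗ sh g) ∎
  where open ≡-Reasoning

⊙-cong : ∀ a {f g} → f ≋ g → a ⊙ f ≋ a ⊙ g
⊙-cong a {f} {g} p = equal λ φ S →
  ≡.trans (eval-⊙ φ a f) (≡.trans (cong (a ℚ.*_) (evals p φ S)) (≡.sym (eval-⊙ φ a g)))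

⊙-⊙ : ∀ a b f → a ⊙ (b ⊙ f) ≋ (a ℚ.* b) ⊙ f
⊙-⊙ a b f = equal λ φ _ → begin
  eval φ (a ⊙ (b ⊙ f))       ≡⟨ eval-⊙ φ a (b ⊙ f) ⟩
  a ℚ.* eval φ (b ⊙ f)       ≡⟨ cong (a ℚ.*_) (eval-⊙ φ b f) ⟩
  a ℚ.* (b ℚ.* eval φ f)     ≡⟨ ℚₚ.*-assoc a b _ ⟨
  a ℚ.* b ℚ.* eval φ f       ≡⟨ eval-⊙ φ (a ℚ.* b) f ⟨
  eval φ ((a ℚ.* b) ⊙ f)     ∎
  where open ≡-Reasoning

1⊙ : ∀ f → 1ℚ ⊙ f ≋ f
1⊙ f = equal λ φ _ → ≡.trans (eval-⊙ φ 1ℚ f) (ℚₚ.*-identityˡ _)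

⊙-+ : ∀ a b f → (a ℚ.+ b) ⊙ f ≋ (a ⊙ f) ⊕ (b ⊙ f)
⊙-+ a b f = equal λ φ _ → begin
  eval φ ((a ℚ.+ b) ⊙ f)               ≡⟨ eval-⊙ φ (a ℚ.+ b) f ⟩
  (a ℚ.+ b) ℚ.* eval φ f               ≡⟨ ℚₚ.*-distribʳ-+ _ a b ⟩
  a ℚ.* eval φ f ℚ.+ b ℚ.* eval φ f    ≡⟨ cong₂ ℚ._+_ (eval-⊙ φ a f) (eval-⊙ φ b f) ⟨
  eval φ (a ⊙ f) ℚ.+ eval φ (b ⊙ f)    ≡⟨ eval-++ φ (a ⊙ f) (b ⊙ f) ⟨
  eval φ ((a ⊙ f) ⊕ (b ⊙ f))           ∎
  where open ≡-Reasoning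

-- Generating functions of h, e, P and R

-- Normalised fractions divide by a gcd that does not compute for a variable `k`; among unnormalised
-- rationals the claim is a cross multiplication.
1+/1 : ∀ k → 1ℚ ℚ.+ (+ k ℚ./ 1) ≡ + suc k ℚ./ 1
1+/1 k = ℚₚ.toℚᵘ-injective (begin
  ℚ.toℚᵘ (1ℚ ℚ.+ (+ k ℚ./ 1))         ≈⟨ ℚₚ.toℚᵘ-homo-+ 1ℚ (+ k ℚ./ 1) ⟩
  ℚ.toℚᵘ 1ℚ ℚᵘ.+ ℚ.toℚᵘ (+ k ℚ./ 1)   ≈⟨ ℚᵘₚ.+-congʳ (ℚ.toℚᵘ 1ℚ) (ℚₚ.toℚᵘ-fromℚᵘ (mkℚᵘ (+ k) 0)) ⟩
  ℚ.toℚᵘ 1ℚ ℚᵘ.+ mkℚᵘ (+ k) 0         ≈⟨ *≡* (cross (+ k)) ⟩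
  mkℚᵘ (+ suc k) 0                    ≈⟨ ℚₚ.toℚᵘ-fromℚᵘ (mkℚᵘ (+ suc k) 0) ⟨
  ℚ.toℚᵘ (+ suc k ℚ./ 1)              ∎)
  where
  open ℚᵘₚ.≃-Reasoning
  cross : ∀ x → (+ 1 ℤ.* + 1 ℤ.+ x ℤ.* + 1) ℤ.* + 1 ≡ (+ 1 ℤ.+ x) ℤ.* + 1
  cross = solve-∀

1/k*k/1 : ∀ k → (+ 1 ℚ./ suc k) ℚ.* (+ suc k ℚ./ 1) ≡ 1ℚ
1/k*k/1 k = ℚₚ.toℚᵘ-injective (begin
  ℚ.toℚᵘ ((+ 1 ℚ./ suc k) ℚ.* (+ suc k ℚ./ 1))
    ≈⟨ ℚₚ.toℚᵘ-homo-* (+ 1 ℚ./ suc k) (+ suc k ℚ./ 1) ⟩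
  ℚ.toℚᵘ (+ 1 ℚ./ suc k) ℚᵘ.* ℚ.toℚᵘ (+ suc k ℚ./ 1)
    ≈⟨ ℚᵘₚ.*-cong (ℚₚ.toℚᵘ-fromℚᵘ (mkℚᵘ (+ 1) k)) (ℚₚ.toℚᵘ-fromℚᵘ (mkℚᵘ (+ suc k) 0)) ⟩
  mkℚᵘ (+ 1) k ℚᵘ.* mkℚᵘ (+ suc k) 0
    ≈⟨ *≡* (cross (+ suc k)) ⟩
  ℚ.toℚᵘ 1ℚ ∎)
  where
  open ℚᵘₚ.≃-Reasoning
  cross : ∀ x → (+ 1 ℤ.* x) ℤ.* + 1 ≡ + 1 ℤ.* (x ℤ.* + 1)
  cross = solve-∀

open CommutativeSemiring Sym-commutativeSemiring
  using (+-identityʳ; *-identityˡ; *-identityʳ; zeroʳ; distribʳ; setoid)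
open Convolution Sym-commutativeSemiring
open import Relation.Binary.Reasoning.Setoid setoid
open import Algebra.Solver.Ring.NaturalCoefficients.Default Sym-commutativeSemiring using (solve; _:+_; _:*_; _:=_; con)

-- Connects the natural multiples in `D` with the rational scalars in `newton`.
ι-⊗ : ∀ k f → ι k ⊗ f ≋ (+ k ℚ./ 1) ⊙ f
ι-⊗ zero f = equal λ φ _ → ≡.sym (≡.trans (eval-⊙ φ 0ℚ f) (ℚₚ.*-zeroˡ (eval φ f)))
ι-⊗ (suc k) f = begin
  (𝟙 ⊕ ι k) ⊗ f                      ≈⟨ distribʳ f 𝟙 (ι k) ⟩
  (𝟙 ⊗ f) ⊕ (ι k ⊗ f)                ≈⟨ ⊕-cong (constant-⊗ 1ℚ f) (ι-⊗ k f) ⟩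
  (1ℚ ⊙ f) ⊕ ((+ k ℚ./ 1) ⊙ f)       ≈⟨ ⊙-+ 1ℚ (+ k ℚ./ 1) f ⟨
  (1ℚ ℚ.+ (+ k ℚ./ 1)) ⊙ f           ≡⟨ cong (_⊙ f) (1+/1 k) ⟩
  (+ suc k ℚ./ 1) ⊙ f                ∎

ι-inverse : ∀ k → constant (+ 1 ℚ./ suc k) ⊗ ι (suc k) ≋ 𝟙
ι-inverse k = begin
  constant (+ 1 ℚ./ suc k) ⊗ ι (suc k)          ≈⟨ constant-⊗ (+ 1 ℚ./ suc k) (ι (suc k)) ⟩
  (+ 1 ℚ./ suc k) ⊙ ι (suc k)                   ≈⟨ ⊙-cong (+ 1 ℚ./ suc k) (*-identityʳ (ι (suc k))) ⟨
  (+ 1 ℚ./ suc k) ⊙ (ι (suc k) ⊗ 𝟙)             ≈⟨ ⊙-cong (+ 1 ℚ./ suc k) (ι-⊗ (suc k) 𝟙) ⟩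
  (+ 1 ℚ./ suc k) ⊙ ((+ suc k ℚ./ 1) ⊙ 𝟙)       ≈⟨ ⊙-⊙ (+ 1 ℚ./ suc k) (+ suc k ℚ./ 1) 𝟙 ⟩
  ((+ 1 ℚ./ suc k) ℚ.* (+ suc k ℚ./ 1)) ⊙ 𝟙     ≡⟨ cong (_⊙ 𝟙) (1/k*k/1 k) ⟩
  1ℚ ⊙ 𝟙                                        ≈⟨ 1⊙ 𝟙 ⟩
  𝟙                                             ∎

weighted : (ℕ → ℚ) → ℕ → Sym
weighted s i = s (suc i) ⊙ pw (suc i)

-- `newton s k` lists its values in descending order, so zipping it with ascending indices is a
-- convolution. The map `g` absorbs the shift of the indices in the tail of `upTo`.
Σ-newton : ∀ s (g : ℕ → ℕ) k →
  Σˢ (zipWith (λ i x → weighted s i ⊗ x) (applyUpTo g (suc k)) (newton s k)) ≋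
  conv (weighted s ∘ g) (hd ∘ newton s) k
Σ-newton s g zero = +-identityʳ _
Σ-newton s g (suc k) = ⊕-cong (≋-refl {weighted s (g 0) ⊗ hd (newton s (suc k))}) (Σ-newton s (g ∘ suc) k)

newton-Newton : ∀ s → Newton (weighted s) (hd ∘ newton s)
newton-Newton s k = begin
  ι (suc k) ⊗ ((+ 1 ℚ./ suc k) ⊙ Z)                       ≈⟨ ⊗-cong (≋-refl {ι (suc k)}) (constant-⊗ (+ 1 ℚ./ suc k) Z) ⟨
  ι (suc k) ⊗ (constant (+ 1 ℚ./ suc k) ⊗ Z)              ≈⟨ ⊗-assoc (ι (suc k)) (constant (+ 1 ℚ./ suc k)) Z ⟨
  (ι (suc k) ⊗ constant (+ 1 ℚ./ suc k)) ⊗ Z              ≈⟨ ⊗-cong (≋-trans (⊗-comm (ι (suc k)) (constant (+ 1 ℚ./ suc k))) (ι-inverse k)) (≋-refl {Z}) ⟩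
  𝟙 ⊗ Z                                                   ≈⟨ *-identityˡ Z ⟩
  Z                                                       ≈⟨ Σ-newton s id k ⟩
  conv (weighted s) (hd ∘ newton s) k                     ∎
  where
  Z : Sym
  Z = Σˢ (zipWith (λ i x → weighted s i ⊗ x) (upTo (suc k)) (newton s k))

sh-⊙ : ∀ a f → sh (a ⊙ f) ≋ a ⊙ sh f
sh-⊙ a f = equal λ φ _ → ≡.trans (eval-sh φ (a ⊙ f)) (≡.trans (eval-⊙ _ a f)
  (≡.trans (cong (a ℚ.*_) (≡.sym (eval-sh φ f))) (≡.sym (eval-⊙ φ a (sh f)))))

sh-conv : ∀ f g m → sh (conv f g m) ≋ conv (sh ∘ f) (sh ∘ g) m
sh-conv f g zero = sh-⊗ (f 0) (g 0)
sh-conv f g (suc m) = begin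
  sh ((f 0 ⊗ g (suc m)) ⊕ conv (f ∘ suc) g m)        ≡⟨ sh-⊕ (f 0 ⊗ g (suc m)) _ ⟩
  sh (f 0 ⊗ g (suc m)) ⊕ sh (conv (f ∘ suc) g m)     ≈⟨ ⊕-cong (sh-⊗ (f 0) (g (suc m))) (sh-conv (f ∘ suc) g m) ⟩
  conv (sh ∘ f) (sh ∘ g) (suc m)                     ∎

-- `sh` is multiplicative and commutes with scalars, so it carries the whole recursion along.
Newton-sh : ∀ {p x} → Newton p x → Newton (sh ∘ p) (sh ∘ x)
Newton-sh {p} {x} N k = begin
  ι (suc k) ⊗ sh (x (suc k))              ≈⟨ ι-⊗ (suc k) _ ⟩
  (+ suc k ℚ./ 1) ⊙ sh (x (suc k))        ≈⟨ sh-⊙ (+ suc k ℚ./ 1) (x (suc k)) ⟨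
  sh ((+ suc k ℚ./ 1) ⊙ x (suc k))        ≈⟨ sh-cong (ι-⊗ (suc k) (x (suc k))) ⟨
  sh (D x (suc k))                        ≈⟨ sh-cong (N k) ⟩
  sh (conv p x k)                         ≈⟨ sh-conv p x k ⟩
  conv (sh ∘ p) (sh ∘ x) k                ∎

alternating : ℕ → ℚ
alternating i = if odd i then 1ℚ else ℚ.- 1ℚ

-- The power-sum terms of `h` and `e` agree at odd index and cancel at even index. The index is
-- `suc i`, so `odd i` being false is the doubling case.
sh-weighted : ∀ i → (weighted (λ _ → 1ℚ) ⊞ weighted alternating) i ≋ sh (weighted (λ _ → 1ℚ) i)
sh-weighted i with odd i
... | false = equal λ φ _ → twice (φ (suc i ∷ []))
  where
  twice : ∀ a → 1ℚ ℚ.* 1ℚ ℚ.* a ℚ.+ (1ℚ ℚ.* 1ℚ ℚ.* a ℚ.+ 0ℚ) ≡ 1ℚ ℚ.* 1ℚ ℚ.* ((1ℚ ℚ.+ 1ℚ) ℚ.* 1ℚ) ℚ.* a ℚ.+ 0ℚ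
  twice a = ≡.trans (cong (1ℚ ℚ.* 1ℚ ℚ.* a ℚ.+_) (ℚₚ.+-identityʳ _))
    (≡.trans (≡.sym (ℚₚ.*-distribʳ-+ a (1ℚ ℚ.* 1ℚ) (1ℚ ℚ.* 1ℚ))) (≡.sym (ℚₚ.+-identityʳ _)))
... | true = equal λ φ _ → cancel (φ (suc i ∷ []))
  where
  cancel : ∀ a → 1ℚ ℚ.* 1ℚ ℚ.* a ℚ.+ ((ℚ.- 1ℚ) ℚ.* 1ℚ ℚ.* a ℚ.+ 0ℚ) ≡ 1ℚ ℚ.* 1ℚ ℚ.* (0ℚ ℚ.* 1ℚ) ℚ.* a ℚ.+ 0ℚ
  cancel a = ≡.trans (cong (1ℚ ℚ.* 1ℚ ℚ.* a ℚ.+_) (ℚₚ.+-identityʳ _))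
    (≡.trans (≡.sym (ℚₚ.*-distribʳ-+ a (1ℚ ℚ.* 1ℚ) ((ℚ.- 1ℚ) ℚ.* 1ℚ))) (≡.sym (ℚₚ.+-identityʳ _)))

-- Both sides are exp (Σ_{k odd} 2 p_k t^k / k).
sh-h : ∀ k → sh (h k) ≋ conv h e k
sh-h = Newton-unique (λ k → constant (+ 1 ℚ./ suc k)) ι-inverse
  (Newton-sh (newton-Newton (λ _ → 1ℚ)))
  (λ k → ≋-trans (Newton-conv (newton-Newton (λ _ → 1ℚ)) (newton-Newton alternating) k)
                 (conv-congˡ (conv h e) k sh-weighted))
  ≋-refl

Σ-conv : ∀ f g n → Σˢ (applyUpTo (λ i → f i ⊗ g (n ∸ i)) (suc n)) ≋ conv f g n
Σ-conv f g zero = +-identityʳ (f 0 ⊗ g 0)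
Σ-conv f g (suc n) = ⊕-cong (≋-refl {f 0 ⊗ g (suc n)}) (Σ-conv (f ∘ suc) g n)

-- The factor ½ in `P` accounts for the 2. At index 0 there is no such factor, whence the `δ` in
-- `q`.
sh-h-suc : ∀ k → sh (h (suc k)) ≋ (𝟙 ⊕ 𝟙) ⊗ P (suc k)
sh-h-suc k = begin
  sh (h (suc k))                  ≈⟨ sh-h (suc k) ⟩
  conv h e (suc k)                ≈⟨ 1⊙ _ ⟨
  (2ℚ ℚ.* ½) ⊙ conv h e (suc k)   ≈⟨ ⊙-⊙ 2ℚ ½ (conv h e (suc k)) ⟨
  2ℚ ⊙ (½ ⊙ conv h e (suc k))     ≈⟨ ⊙-cong 2ℚ (⊙-cong ½ (≋-trans (≋-reflexive (cong Σˢ (Listₚ.map-applyUpTo id (λ i → h i ⊗ e (suc k ∸ i)) (suc (suc k))))) (Σ-conv h e (suc k)))) ⟨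
  2ℚ ⊙ P (suc k)                  ≈⟨ ⊙-+ 1ℚ 1ℚ (P (suc k)) ⟩
  (1ℚ ⊙ P (suc k)) ⊕ (1ℚ ⊙ P (suc k)) ≈⟨ ⊕-cong (constant-⊗ 1ℚ (P (suc k))) (constant-⊗ 1ℚ (P (suc k))) ⟨
  (𝟙 ⊗ P (suc k)) ⊕ (𝟙 ⊗ P (suc k)) ≈⟨ distribʳ (P (suc k)) 𝟙 𝟙 ⟨
  (𝟙 ⊕ 𝟙) ⊗ P (suc k)             ∎
  where
  2ℚ : ℚ
  2ℚ = 1ℚ ℚ.+ 1ℚ

-- The odd and the positive even part of `P`; `E` omits P_0 = 1 because an empty spot is not an even
-- one.
O E : ℕ → Sym
O k = if odd k then P k else []
E zero = []
E (suc k) = if odd (suc k) then [] else P (suc k)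

open BracketedPaths O E ≋-refl ≋-refl ≋-refl

q-sh-h : ∀ k → q k ≋ sh (h k)
q-sh-h zero = equal λ _ _ → ≡.refl
q-sh-h (suc k) = ≋-trans split (≋-sym (sh-h-suc k))
  where
  split : q (suc k) ≋ two ⊗ P (suc k)
  split with odd k
  ... | true = ⊕-cong (zeroʳ two) (≋-refl {two ⊗ P (suc k)})
  ... | false = ≋-trans (⊕-cong (≋-refl {two ⊗ P (suc k)}) (zeroʳ two)) (+-identityʳ (two ⊗ P (suc k)))

double : ℕ → ℕ
double zero = 0
double (suc k) = suc (suc (double k))

double-* : ∀ k → 2 ℕ.* k ≡ double k
double-* zero = ≡.refl
double-* (suc k) = cong suc (≡.trans (ℕₚ.+-suc k (k ℕ.+ 0)) (cong suc (double-* k)))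

double-∸ : ∀ i j → double i ∸ double j ≡ double (i ∸ j)
double-∸ i zero = ≡.refl
double-∸ zero (suc j) = ≡.refl
double-∸ (suc i) (suc j) = double-∸ i j

⌊double/2⌋ : ∀ k → ⌊ double k /2⌋ ≡ k
⌊double/2⌋ zero = ≡.refl
⌊double/2⌋ (suc k) = cong suc (⌊double/2⌋ k)

odd-double : ∀ k → odd (double k) ≡ false
odd-double zero = ≡.refl
odd-double (suc k) = cong (not ∘ not) (odd-double k)

parity : ∀ x → (∃ λ k → x ≡ double k) ⊎ (∃ λ k → x ≡ suc (double k))
parity zero = inj₁ (0 , ≡.refl)
parity (suc x) with parity x
... | inj₁ (k , ≡.refl) = inj₂ (k , ≡.refl)
... | inj₂ (k , ≡.refl) = inj₁ (suc k , ≡.refl)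

OddFree : (ℕ → Sym) → Set
OddFree f = ∀ k → f (suc (double k)) ≋ []

⊗-vanishˡ : ∀ {f} g → f ≋ [] → f ⊗ g ≋ []
⊗-vanishˡ g f≋0 = ⊗-cong f≋0 (≋-refl {g})

⊗-vanishʳ : ∀ f {g} → g ≋ [] → f ⊗ g ≋ []
⊗-vanishʳ f g≋0 = ≋-trans (⊗-cong (≋-refl {f}) g≋0) (zeroʳ f)

conv-odd : ∀ f g → OddFree f → OddFree g → OddFree (conv f g)
conv-odd f g p r zero = ⊕-cong (⊗-vanishʳ (f 0) (r 0)) (⊗-vanishˡ (g 0) (p 0))
conv-odd f g p r (suc k) = ⊕-cong (⊗-vanishʳ (f 0) (r (suc k)))
  (⊕-cong (⊗-vanishˡ _ (p 0)) (conv-odd (f ∘ suc ∘ suc) g (p ∘ suc) r k))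

conv-even : ∀ f g → OddFree f → ∀ k →
  conv f g (double k) ≋ Σˢ (applyUpTo (λ j → f (double j) ⊗ g (double k ∸ double j)) (suc k))
conv-even f g p zero = ≋-sym (+-identityʳ (f 0 ⊗ g 0))
conv-even f g p (suc k) = ⊕-cong (≋-refl {f 0 ⊗ g (double (suc k))})
  (⊕-cong (⊗-vanishˡ _ (p 0)) (conv-even (f ∘ suc ∘ suc) g (p ∘ suc) k))

E-oddFree : OddFree E
E-oddFree k rewrite odd-double k = ≋-refl

U-oddFree : OddFree U
U-oddFree = E-oddFree

E-even : ∀ k → E (double (suc k)) ≡ P (double (suc k))
E-even k rewrite odd-double k = ≡.refl

U-even : ∀ k → U (double k) ≋ P (double k)
U-even zero = ≋-refl
U-even (suc k) = ≋-reflexive (E-even k)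

Σ-cong : ∀ {f g} n → (∀ i → f i ≋ g i) → Σˢ (applyUpTo f n) ≋ Σˢ (applyUpTo g n)
Σ-cong zero p = ≋-refl
Σ-cong (suc n) p = ⊕-cong (p 0) (Σ-cong n (p ∘ suc))

R-double : ∀ k → R (double k) ≋ conv E U (double k)
R-double k rewrite odd-double k | ⌊double/2⌋ k =
  ≋-trans (≋-reflexive (cong Σˢ (Listₚ.map-applyUpTo id (λ j → P (2 ℕ.* suc j) ⊗ P (double k ∸ 2 ℕ.* suc j)) k)))
    -- The term of `conv-even` at index 0 vanishes by computation, `E 0` being the empty list; this
    -- matches the sum in `R`, which starts at `suc j`.
    (≋-trans (Σ-cong k term) (≋-sym (conv-even E U E-oddFree k)))
  where
  term : ∀ j → P (2 ℕ.* suc j) ⊗ P (double k ∸ 2 ℕ.* suc j) ≋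
               E (double (suc j)) ⊗ U (double k ∸ double (suc j))
  term j = ⊗-cong
    (≋-reflexive (≡.trans (cong P (double-* (suc j))) (≡.sym (E-even j))))
    (≋-trans (≋-reflexive (cong P (≡.trans (cong (double k ∸_) (double-* (suc j))) (double-∸ k (suc j)))))
      (≋-trans (≋-sym (U-even (k ∸ suc j))) (≋-reflexive (cong U (≡.sym (double-∸ k (suc j)))))))

R-even : ∀ x → odd x ≡ false → R x ≋ conv E U x
R-even x ev with parity x
... | inj₁ (k , ≡.refl) = R-double k
... | inj₂ (k , ≡.refl) rewrite odd-double k with () ← ev

-- Silences the even-spot term at odd occupancies, so that one formula covers all spots in
-- `garageWeight-∷`.
EU-odd : ∀ x → odd x ≡ true → conv E U x ≋ []
EU-odd x od with parity x
... | inj₁ (k , ≡.refl) rewrite odd-double k with () ← od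
... | inj₂ (k , ≡.refl) = conv-odd E U E-oddFree U-oddFree k

-- Sign vectors of garages

sumOver : {A : Set} → (A → Sym) → List A → Sym
sumOver f xs = Σˢ (map f xs)

sumOver-cong : {A : Set} {f g : A → Sym} → (∀ x → f x ≋ g x) → ∀ xs → sumOver f xs ≋ sumOver g xs
sumOver-cong p [] = ≋-refl
sumOver-cong p (x ∷ xs) = ⊕-cong (p x) (sumOver-cong p xs)

sumOver-[] : {A : Set} (xs : List A) → sumOver (λ _ → []) xs ≋ []
sumOver-[] [] = ≋-refl
sumOver-[] (x ∷ xs) = sumOver-[] xs

sumOver-++ : {A : Set} (f : A → Sym) (xs ys : List A) → sumOver f (xs ++ ys) ≋ sumOver f xs ⊕ sumOver f ys
sumOver-++ f [] ys = ≋-refl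
sumOver-++ f (x ∷ xs) ys = ≋-trans (⊕-cong (≋-refl {f x}) (sumOver-++ f xs ys))
  (≋-reflexive (≡.sym (Listₚ.++-assoc (f x) (sumOver f xs) (sumOver f ys))))

sumOver-map : {A B : Set} (f : B → Sym) (g : A → B) (xs : List A) → sumOver f (map g xs) ≡ sumOver (f ∘ g) xs
sumOver-map f g xs = cong Σˢ (≡.sym (Listₚ.map-∘ xs))

sumOver-concatMap : {A B : Set} (f : B → Sym) (g : A → List B) (xs : List A) →
                    sumOver f (concatMap g xs) ≋ sumOver (λ x → sumOver f (g x)) xs
sumOver-concatMap f g [] = ≋-refl
sumOver-concatMap f g (x ∷ xs) = ≋-trans (sumOver-++ f (g x) (concatMap g xs))
  (⊕-cong (≋-refl {sumOver f (g x)}) (sumOver-concatMap f g xs))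

sumOver-filter : {A : Set} (f : A → Sym) (b : A → Bool) (xs : List A) →
                 sumOver f (filterᵇ b xs) ≋ sumOver (λ x → if b x then f x else []) xs
sumOver-filter f b [] = ≋-refl
sumOver-filter f b (x ∷ xs) with b x
... | true = ⊕-cong (≋-refl {f x}) (sumOver-filter f b xs)
... | false = sumOver-filter f b xs

data Kind : Set where
  emptyᵏ oddᵏ evenᵏ : Kind

kind : ℕ → Kind
kind zero = emptyᵏ
kind (suc x) = if odd (suc x) then oddᵏ else evenᵏ

kindCode : Kind → ℕ
kindCode emptyᵏ = 0
kindCode oddᵏ = 1
kindCode evenᵏ = 2

-- The number of sign vectors accepted by `scan`, as an element of `Sym`.
κ : ℕ → List Kind → Sym
κ d [] = 𝟙
κ d (emptyᵏ ∷ w) = κ (ℕ.pred d) w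
κ d (oddᵏ ∷ w) = two ⊗ κ d w
κ d (evenᵏ ∷ w) = opening d ⊗ κ (suc d) w

-- Even spots open a bracket and empty spots close one; s is the sign of the current outermost
-- bracket, and d counts the open ones.
check : Kind → ℕ → ℤ → ℤ → (ℕ → ℤ → Bool) → Bool
check emptyᵏ d s x k = eqℤ x (+ 0) ∧ k (ℕ.pred d) s
check oddᵏ d s x k = not (eqℤ x (+ 0)) ∧ k d s
check evenᵏ zero s x k = not (eqℤ x (+ 0)) ∧ k 1 x
check evenᵏ (suc d) s x k = eqℤ s x ∧ k (suc (suc d)) s

scan : ℕ → ℕ → ℤ → (ℕ → Kind) → (ℕ → ℤ) → Bool
scan zero d s v z = true
scan (suc c) d s v z = check (v 0) d s (z 0) (λ d′ s′ → scan c d′ s′ (v ∘ suc) (z ∘ suc))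

-- Spots are numbered from 0 in the recursions, whereas `ith` counts from 1.
signAt : List ℤ → ℕ → ℤ
signAt σ i = ith (suc i) σ

-1ℤ 0ℤ 1ℤ : ℤ
-1ℤ = ℤ.- (+ 1)
0ℤ = + 0
1ℤ = + 1

Unit : ℤ → Set
Unit s = s ≡ -1ℤ ⊎ s ≡ 1ℤ

sumOver-tuples : (W : List ℤ → Sym) (c : ℕ) → let V = λ x → sumOver (λ σ → W (x ∷ σ)) (tuples c signs) in
                 sumOver W (tuples (suc c) signs) ≋ V -1ℤ ⊕ (V 0ℤ ⊕ V 1ℤ)
sumOver-tuples W c = begin
  sumOver W (tuples (suc c) signs)
    ≈⟨ sumOver-concatMap W (λ x → map (x ∷_) (tuples c signs)) signs ⟩
  S -1ℤ ⊕ (S 0ℤ ⊕ (S 1ℤ ⊕ []))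
    ≈⟨ ⊕-cong (eq -1ℤ) (⊕-cong (eq 0ℤ) (≋-trans (+-identityʳ (S 1ℤ)) (eq 1ℤ))) ⟩
  _ ∎
  where
  S : ℤ → Sym
  S x = sumOver W (map (x ∷_) (tuples c signs))
  eq : ∀ x → S x ≋ sumOver (λ σ → W (x ∷ σ)) (tuples c signs)
  eq x = ≋-reflexive (sumOver-map W (x ∷_) (tuples c signs))

two-⊗ : ∀ f → f ⊕ f ≋ two ⊗ f
two-⊗ f = ≋-sym (≋-trans (distribʳ f 𝟙 𝟙) (⊕-cong (*-identityˡ f) (*-identityˡ f)))

-- `Unit s` makes the sign forced inside a bracket one of the letters in `signs`, so exactly one of
-- the three choices survives at an inner even spot.
sumOver-scan : ∀ X c d s v → Unit s →
  sumOver (λ σ → if scan c d s v (signAt σ) then X else []) (tuples c signs) ≋ κ d (applyUpTo v c) ⊗ X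
sumOver-scan X zero d s v _ = ≋-trans (+-identityʳ X) (≋-sym (*-identityˡ X))
sumOver-scan X (suc c) d s v u =
  ≋-trans (sumOver-tuples (λ σ → if scan (suc c) d s v (signAt σ) then X else []) c) (step d s u)
  where
  0s : sumOver (λ _ → []) (tuples c signs) ≋ []
  0s = sumOver-[] (tuples c signs)

  IH : ∀ d s → Unit s →
    sumOver (λ σ → if scan c d s (v ∘ suc) (signAt σ) then X else []) (tuples c signs) ≋
    κ d (applyUpTo (v ∘ suc) c) ⊗ X
  IH d s u = sumOver-scan X c d s (v ∘ suc) u

  both : ∀ {a b} d → a ≋ κ d (applyUpTo (v ∘ suc) c) ⊗ X → b ≋ κ d (applyUpTo (v ∘ suc) c) ⊗ X →
         a ⊕ (sumOver (λ _ → []) (tuples c signs) ⊕ b) ≋ (two ⊗ κ d (applyUpTo (v ∘ suc) c)) ⊗ X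
  both d p r = ≋-trans (⊕-cong p (⊕-cong 0s r))
    (≋-trans (two-⊗ (κ d (applyUpTo (v ∘ suc) c) ⊗ X)) (≋-sym (⊗-assoc two (κ d (applyUpTo (v ∘ suc) c)) X)))

  V : ℕ → ℤ → ℤ → Sym
  V d s x = sumOver (λ σ → if scan (suc c) d s v (signAt (x ∷ σ)) then X else []) (tuples c signs)

  step : ∀ d s → Unit s → V d s -1ℤ ⊕ (V d s 0ℤ ⊕ V d s 1ℤ) ≋ κ d (applyUpTo v (suc c)) ⊗ X
  step d s u with v 0
  ... | emptyᵏ = ≋-trans (⊕-cong 0s (⊕-cong (IH (ℕ.pred d) s u) 0s)) (+-identityʳ _)
  ... | oddᵏ = both d (IH d s u) (IH d s u)
  step zero s u | evenᵏ = both 1 (IH 1 -1ℤ (inj₁ ≡.refl)) (IH 1 1ℤ (inj₂ ≡.refl))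
  step (suc d) s u@(inj₁ ≡.refl) | evenᵏ =
    ≋-trans (⊕-cong (IH (suc (suc d)) -1ℤ u) (⊕-cong 0s 0s))
      (≋-trans (+-identityʳ _) (⊗-cong (≋-sym (*-identityˡ (κ (suc (suc d)) (applyUpTo (v ∘ suc) c)))) (≋-refl {X})))
  step (suc d) s u@(inj₂ ≡.refl) | evenᵏ =
    ≋-trans (⊕-cong 0s (⊕-cong 0s (IH (suc (suc d)) 1ℤ u)))
      (⊗-cong (≋-sym (*-identityˡ (κ (suc (suc d)) (applyUpTo (v ∘ suc) c)))) (≋-refl {X}))

-- The left-to-right scan agrees with the pairwise garage condition

Match : Kind → ℤ → Set
Match emptyᵏ x = x ≡ + 0
Match oddᵏ x = x ≢ + 0
Match evenᵏ x = x ≢ + 0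

Compatible : ℕ → (ℕ → Kind) → (ℕ → ℤ) → Set
Compatible zero v z = ⊤
Compatible (suc c) v z = Match (v 0) (z 0) × Compatible c (v ∘ suc) (z ∘ suc)

reachStep : Kind → ℕ → ℤ → ℤ → (ℕ → Set) → Set
reachStep emptyᵏ zero s x k = ⊤
reachStep emptyᵏ (suc h) s x k = k h
reachStep oddᵏ h s x k = k h
reachStep evenᵏ h s x k = s ≡ x × k (suc h)

-- All even spots before the closing of the bracket in which h further brackets are open have sign s.
Reach : ℤ → ℕ → ℕ → (ℕ → Kind) → (ℕ → ℤ) → Set
Reach s h zero v z = ⊤
Reach s h (suc c) v z = reachStep (v 0) h s (z 0) (λ h′ → Reach s h′ c (v ∘ suc) (z ∘ suc))

-- Depth `suc h` is the outermost bracket together with `h` further ones.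
ReachIfOpen : ℤ → ℕ → ℕ → (ℕ → Kind) → (ℕ → ℤ) → Set
ReachIfOpen s zero c v z = ⊤
ReachIfOpen s (suc h) c v z = Reach s h c v z

IfEven : Kind → Set → Set
IfEven evenᵏ A = A
IfEven _ A = ⊤

Garage : ℕ → (ℕ → Kind) → (ℕ → ℤ) → Set
Garage zero v z = ⊤
Garage (suc c) v z = IfEven (v 0) (Reach (z 0) 0 c (v ∘ suc) (z ∘ suc)) × Garage c (v ∘ suc) (z ∘ suc)

-- With fewer brackets open the closing comes no later, so fewer spots are constrained.
Reach-antitone : ∀ {s h h′} c v z → h ≤ h′ → Reach s h′ c v z → Reach s h c v z
Reach-antitone zero v z h≤h′ r = tt
Reach-antitone {h = zero} (suc c) v z h≤h′ r with v 0
... | emptyᵏ = tt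
... | oddᵏ = Reach-antitone c _ _ h≤h′ r
... | evenᵏ = proj₁ r , Reach-antitone c _ _ (s≤s h≤h′) (proj₂ r)
Reach-antitone {h = suc h} {suc h′} (suc c) v z (s≤s h≤h′) r with v 0
... | emptyᵏ = Reach-antitone c _ _ h≤h′ r
... | oddᵏ = Reach-antitone c _ _ (s≤s h≤h′) r
... | evenᵏ = proj₁ r , Reach-antitone c _ _ (s≤s (s≤s h≤h′)) (proj₂ r)

-- Inside a bracket `check` only compares with `s`; that inner even spots have nonzero sign is
-- inherited from `s ≢ + 0`.
scan⇒ : ∀ c d s v z → s ≢ + 0 → T (scan c d s v z) → Compatible c v z × ReachIfOpen s d c v z × Garage c v z
scan⇒ zero zero s v z s≢0 t = tt , tt , tt
scan⇒ zero (suc d) s v z s≢0 t = tt , tt , tt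
scan⇒ (suc c) zero s v z s≢0 t with v 0
... | emptyᵏ =
  let (x , t′) = to T-∧ t
      (m , r , g) = scan⇒ c 0 s _ _ s≢0 t′
  in (toWitness x , m) , tt , (tt , g)
... | oddᵏ =
  let (x , t′) = to T-∧ t
      (m , r , g) = scan⇒ c 0 s _ _ s≢0 t′
  in (toWitnessFalse x , m) , tt , (tt , g)
... | evenᵏ =
  let (x , t′) = to T-∧ t
      (m , r , g) = scan⇒ c 1 (z 0) _ _ (toWitnessFalse x) t′
  in (toWitnessFalse x , m) , tt , (r , g)
scan⇒ (suc c) (suc d) s v z s≢0 t with v 0
... | oddᵏ =
  let (x , t′) = to T-∧ t
      (m , r , g) = scan⇒ c (suc d) s _ _ s≢0 t′
  in (toWitnessFalse x , m) , r , (tt , g)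
... | evenᵏ =
  let (x , t′) = to T-∧ t
      s≡z = toWitness x
      (m , r , g) = scan⇒ c (suc (suc d)) s _ _ s≢0 t′
  in ((λ z≡0 → s≢0 (≡.trans s≡z z≡0)) , m) , (s≡z , r)
   -- The bracket opened here lies within the outermost one, whose sign it shares.
   , (≡.subst (λ s → Reach s 0 c _ _) s≡z (Reach-antitone c _ _ z≤n r) , g)
scan⇒ (suc c) (suc zero) s v z s≢0 t | emptyᵏ =
  let (x , t′) = to T-∧ t
      (m , r , g) = scan⇒ c 0 s _ _ s≢0 t′
  in (toWitness x , m) , tt , (tt , g)
scan⇒ (suc c) (suc (suc d)) s v z s≢0 t | emptyᵏ =
  let (x , t′) = to T-∧ t
      (m , r , g) = scan⇒ c (suc d) s _ _ s≢0 t′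
  in (toWitness x , m) , r , (tt , g)

scan⇐ : ∀ c d s v z → Compatible c v z → ReachIfOpen s d c v z → Garage c v z → T (scan c d s v z)
scan⇐ zero d s v z m r g = tt
scan⇐ (suc c) zero s v z m r g with v 0
... | emptyᵏ = from T-∧ (fromWitness (proj₁ m) , scan⇐ c 0 s _ _ (proj₂ m) tt (proj₂ g))
... | oddᵏ = from T-∧ (fromWitnessFalse (proj₁ m) , scan⇐ c 0 s _ _ (proj₂ m) tt (proj₂ g))
... | evenᵏ = from T-∧ (fromWitnessFalse (proj₁ m) , scan⇐ c 1 (z 0) _ _ (proj₂ m) (proj₁ g) (proj₂ g))
scan⇐ (suc c) (suc d) s v z m r g with v 0
... | oddᵏ = from T-∧ (fromWitnessFalse (proj₁ m) , scan⇐ c (suc d) s _ _ (proj₂ m) r (proj₂ g))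
... | evenᵏ = from T-∧ (fromWitness (proj₁ r) , scan⇐ c (suc (suc d)) s _ _ (proj₂ m) (proj₂ r) (proj₂ g))
scan⇐ (suc c) (suc zero) s v z m r g | emptyᵏ =
  from T-∧ (fromWitness (proj₁ m) , scan⇐ c 0 s _ _ (proj₂ m) tt (proj₂ g))
scan⇐ (suc c) (suc (suc d)) s v z m r g | emptyᵏ =
  from T-∧ (fromWitness (proj₁ m) , scan⇐ c (suc d) s _ _ (proj₂ m) r (proj₂ g))

word : (ℕ → Kind) → ℕ → List ℕ
word v = applyUpTo (kindCode ∘ v)

Nonnegative : (ℕ → Kind) → ℕ → ℕ → Set
Nonnegative v h t = ∀ r → r ≤ t → cnt 0 (word v r) ≤ h ℕ.+ cnt 2 (word v r)

ReachAt : ℤ → ℕ → ℕ → (ℕ → Kind) → (ℕ → ℤ) → Set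
ReachAt s h c v z = ∀ t → t < c → v t ≡ evenᵏ → Nonnegative v h t → s ≡ z t

-- The closing is the end of the first prefix whose zeros exceed its twos by more than `h`;
-- `Nonnegative` therefore says that spot `t` comes before it.
Reach⇒ReachAt : ∀ s h c v z → Reach s h c v z → ReachAt s h c v z
Reach⇒ReachAt s h (suc c) v z r zero _ ev _ with v 0 | ev
... | evenᵏ | _ = proj₁ r
-- Abstracting the shifted prefix condition together with `v 0` lets the count of the first letter
-- compute.
Reach⇒ReachAt s h (suc c) v z r (suc t) (s≤s t<c) ev nn with v 0 | h | (λ r r≤t → nn (suc r) (s≤s r≤t))
... | emptyᵏ | zero | nn′ with () ← nn′ 0 z≤n
... | emptyᵏ | suc h | nn′ = Reach⇒ReachAt s h c _ _ r t t<c ev (λ r r≤t → ℕₚ.≤-pred (nn′ r r≤t))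
... | oddᵏ | h | nn′ = Reach⇒ReachAt s h c _ _ r t t<c ev nn′
... | evenᵏ | h | nn′ = Reach⇒ReachAt s (suc h) c _ _ (proj₂ r) t t<c ev
  (λ r r≤t → ℕₚ.≤-trans (nn′ r r≤t) (ℕₚ.≤-reflexive (ℕₚ.+-suc h _)))

ReachAt⇒Reach : ∀ s h c v z → ReachAt s h c v z → Reach s h c v z
ReachAt⇒Reach s h zero v z p = tt
ReachAt⇒Reach s h (suc c) v z p with v 0 in eq
ReachAt⇒Reach s zero (suc c) v z p | emptyᵏ = tt
ReachAt⇒Reach s (suc h) (suc c) v z p | emptyᵏ = ReachAt⇒Reach s h c _ _ λ t t<c ev nn →
  p (suc t) (s≤s t<c) ev λ where
    zero _ → z≤n
    (suc r) (s≤s r≤t) → head r (nn r r≤t)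
  where
  head : ∀ r → cnt 0 (word (v ∘ suc) r) ≤ h ℕ.+ cnt 2 (word (v ∘ suc) r) →
         cnt 0 (word v (suc r)) ≤ suc h ℕ.+ cnt 2 (word v (suc r))
  head r q rewrite eq = s≤s q
ReachAt⇒Reach s h (suc c) v z p | oddᵏ = ReachAt⇒Reach s h c _ _ λ t t<c ev nn →
  p (suc t) (s≤s t<c) ev λ where
    zero _ → z≤n
    (suc r) (s≤s r≤t) → head r (nn r r≤t)
  where
  head : ∀ r → cnt 0 (word (v ∘ suc) r) ≤ h ℕ.+ cnt 2 (word (v ∘ suc) r) →
         cnt 0 (word v (suc r)) ≤ h ℕ.+ cnt 2 (word v (suc r))
  head r q rewrite eq = q
ReachAt⇒Reach s h (suc c) v z p | evenᵏ = p 0 (s≤s z≤n) eq (λ { zero _ → z≤n }) ,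
  ReachAt⇒Reach s (suc h) c _ _ λ t t<c ev nn →
  p (suc t) (s≤s t<c) ev λ where
    zero _ → z≤n
    (suc r) (s≤s r≤t) → head r (nn r r≤t)
  where
  head : ∀ r → cnt 0 (word (v ∘ suc) r) ≤ suc h ℕ.+ cnt 2 (word (v ∘ suc) r) →
         cnt 0 (word v (suc r)) ≤ h ℕ.+ cnt 2 (word v (suc r))
  head r q rewrite eq = ℕₚ.≤-trans q (ℕₚ.≤-reflexive (≡.sym (ℕₚ.+-suc h _)))

-- The later spot is written `suc i + t`, so that the word strictly between the two spots has length
-- `t`.
GarageAt : ℕ → (ℕ → Kind) → (ℕ → ℤ) → Set
GarageAt c v z = ∀ i t → suc i ℕ.+ t < c → v i ≡ evenᵏ → v (suc i ℕ.+ t) ≡ evenᵏ →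
                 Nonnegative (λ x → v (suc i ℕ.+ x)) 0 t → z i ≡ z (suc i ℕ.+ t)

Garage⇒GarageAt : ∀ c v z → Garage c v z → GarageAt c v z
Garage⇒GarageAt (suc c) v z g zero t (s≤s t<c) ev ev′ nn with v 0 | ev
... | evenᵏ | _ = Reach⇒ReachAt (z 0) 0 c _ _ (proj₁ g) t t<c ev′ nn
Garage⇒GarageAt (suc c) v z g (suc i) t (s≤s lt) ev ev′ nn =
  Garage⇒GarageAt c _ _ (proj₂ g) i t lt ev ev′ nn

GarageAt⇒Garage : ∀ c v z → GarageAt c v z → Garage c v z
GarageAt⇒Garage zero v z p = tt
GarageAt⇒Garage (suc c) v z p = first , GarageAt⇒Garage c _ _ (λ i t lt → p (suc i) t (s≤s lt))
  where
  first : IfEven (v 0) (Reach (z 0) 0 c (v ∘ suc) (z ∘ suc))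
  first with v 0 in eq
  ... | emptyᵏ = tt
  ... | oddᵏ = tt
  ... | evenᵏ = ReachAt⇒Reach (z 0) 0 c _ _ (λ t t<c → p 0 t (s≤s t<c) eq)

CompatibleAt : ℕ → (ℕ → Kind) → (ℕ → ℤ) → Set
CompatibleAt c v z = ∀ i → i < c → Match (v i) (z i)

Compatible⇒CompatibleAt : ∀ c v z → Compatible c v z → CompatibleAt c v z
Compatible⇒CompatibleAt (suc c) v z m zero _ = proj₁ m
Compatible⇒CompatibleAt (suc c) v z m (suc i) (s≤s i<c) = Compatible⇒CompatibleAt c _ _ (proj₂ m) i i<c

CompatibleAt⇒Compatible : ∀ c v z → CompatibleAt c v z → Compatible c v z
CompatibleAt⇒Compatible zero v z m = tt
CompatibleAt⇒Compatible (suc c) v z m =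
  m 0 (s≤s z≤n) , CompatibleAt⇒Compatible c _ _ (λ i i<c → m (suc i) (s≤s i<c))

-- Reflection of the Boolean tests

allB-applyUpTo : ∀ (P : ℕ → Bool) (g : ℕ → ℕ) n →
                 T (allB P (applyUpTo g n)) ⇔ (∀ k → k < n → T (P (g k)))
allB-applyUpTo P g zero = mk⇔ (λ _ _ ()) (λ _ → tt)
allB-applyUpTo P g (suc n) = mk⇔
  (λ t → λ where
    zero _ → proj₁ (to T-∧ t)
    (suc k) (s≤s k<n) → to (allB-applyUpTo P (g ∘ suc) n) (proj₂ (to T-∧ t)) k k<n)
  (λ p → from T-∧ (p 0 (s≤s z≤n) , from (allB-applyUpTo P (g ∘ suc) n) (λ k k<n → p (suc k) (s≤s k<n))))

range1-applyUpTo : ∀ n → range1 n ≡ applyUpTo suc n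
range1-applyUpTo n = Listₚ.map-applyUpTo id suc n

allB-range1 : ∀ (P : ℕ → Bool) n → T (allB P (range1 n)) ⇔ (∀ k → k < n → T (P (suc k)))
allB-range1 P n rewrite range1-applyUpTo n = allB-applyUpTo P suc n

T-⇒ : ∀ a b → T (not a ∨ b) ⇔ (T a → T b)
T-⇒ true b = mk⇔ (λ t _ → t) (λ f → f tt)
T-⇒ false b = mk⇔ (λ _ ()) (λ _ → tt)

kindAt : List ℕ → ℕ → Kind
kindAt p k = kind (α (suc k) p)

υ-kind : ∀ p k → υ p (suc k) ≡ kindCode (kindAt p k)
υ-kind p k with α (suc k) p
... | zero = ≡.refl
... | suc x with odd (suc x)
...   | true = ≡.refl
...   | false = ≡.refl

kindCode-2 : ∀ k → T (kindCode k ≡ᵇ 2) ⇔ (k ≡ evenᵏ)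
kindCode-2 emptyᵏ = mk⇔ (λ ()) (λ ())
kindCode-2 oddᵏ = mk⇔ (λ ()) (λ ())
kindCode-2 evenᵏ = mk⇔ (λ _ → ≡.refl) (λ _ → tt)

υ-even : ∀ p k → T (υ p (suc k) ≡ᵇ 2) ⇔ (kindAt p k ≡ evenᵏ)
υ-even p k rewrite υ-kind p k = kindCode-2 (kindAt p k)

applyUpTo-cong : ∀ {A : Set} {f g : ℕ → A} n → (∀ k → f k ≡ g k) → applyUpTo f n ≡ applyUpTo g n
applyUpTo-cong zero p = ≡.refl
applyUpTo-cong (suc n) p = cong₂ _∷_ (p 0) (applyUpTo-cong n (p ∘ suc))

take-applyUpTo : ∀ {A : Set} (f : ℕ → A) {k n} → k ≤ n → take k (applyUpTo f n) ≡ applyUpTo f k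
take-applyUpTo f z≤n = ≡.refl
take-applyUpTo f (s≤s k≤n) = cong (f 0 ∷_) (take-applyUpTo (f ∘ suc) k≤n)

between-word : ∀ p i t → between p (suc i) (suc (suc i ℕ.+ t)) ≡ word (λ x → kindAt p (suc i ℕ.+ x)) t
between-word p i t = ≡.trans (cong (λ n → map _ (upTo n)) gap)
  (≡.trans (Listₚ.map-applyUpTo id _ t) (applyUpTo-cong t (λ k → υ-kind p (suc i ℕ.+ k))))
  where
  gap : suc (suc i ℕ.+ t) ∸ suc i ∸ 1 ≡ t
  gap = cong (_∸ 1) (≡.trans (cong (_∸ i) (≡.sym (ℕₚ.+-suc i t))) (ℕₚ.m+n∸m≡n i (suc t)))

prefixOK-word : ∀ v t → T (prefixOK (word v t)) ⇔ Nonnegative v 0 t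
prefixOK-word v t = mk⇔
  (λ ok r r≤t → ≡.subst (λ w → cnt 0 w ≤ cnt 2 w) (take-applyUpTo (kindCode ∘ v) r≤t)
     (ℕₚ.≤ᵇ⇒≤ _ _ (to all ok r (s≤s (≡.subst (r ≤_) (≡.sym len) r≤t)))))
  (λ nn → from all (λ r r<n → let r≤t = ≡.subst (r ≤_) len (ℕₚ.≤-pred r<n) in
     ℕₚ.≤⇒≤ᵇ (≡.subst (λ w → cnt 0 w ≤ cnt 2 w) (≡.sym (take-applyUpTo (kindCode ∘ v) r≤t)) (nn r r≤t))))
  where
  len : length (word v t) ≡ t
  len = Listₚ.length-applyUpTo (kindCode ∘ v) t
  all = allB-applyUpTo (λ k → cnt 0 (take k (word v t)) ≤ᵇ cnt 2 (take k (word v t))) id (suc (length (word v t)))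

compatB⇔ : ∀ n p σ → T (compatB n p σ) ⇔ CompatibleAt n (kindAt p) (signAt σ)
compatB⇔ n p σ = mk⇔
  (λ t k k<n → to (match k) (to (allB-range1 _ n) t k k<n))
  (λ m → from (allB-range1 _ n) (λ k k<n → from (match k) (m k k<n)))
  where
  match : ∀ k → T (eqℤ (ith (suc k) σ) (+ 0) ∧ (α (suc k) p ≡ᵇ 0) ∨
                   not (eqℤ (ith (suc k) σ) (+ 0)) ∧ not (α (suc k) p ≡ᵇ 0)) ⇔
              Match (kindAt p k) (signAt σ k)
  match k with α (suc k) p | ith (suc k) σ ℤ.≟ + 0
  ... | zero | yes z≡0 = mk⇔ (λ _ → z≡0) (λ _ → tt)
  ... | zero | no z≢0 = mk⇔ (λ ()) (λ z≡0 → z≢0 z≡0)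
  ... | suc x | dec with odd (suc x)
  match k | suc x | yes z≡0 | true = mk⇔ (λ ()) (λ z≢0 → z≢0 z≡0)
  match k | suc x | yes z≡0 | false = mk⇔ (λ ()) (λ z≢0 → z≢0 z≡0)
  match k | suc x | no z≢0 | true = mk⇔ (λ _ → z≢0) (λ _ → tt)
  match k | suc x | no z≢0 | false = mk⇔ (λ _ → z≢0) (λ _ → tt)

garageB⇔ : ∀ n p σ → T (garageB n p σ) ⇔ GarageAt n (kindAt p) (signAt σ)
garageB⇔ n p σ = mk⇔ ⇒ ⇐
  where
  premise : ℕ → ℕ → Bool
  premise i j = (i <ᵇ j) ∧ (υ p i ≡ᵇ 2) ∧ (υ p j ≡ᵇ 2) ∧ prefixOK (between p i j)
  ⇒ : T (garageB n p σ) → GarageAt n (kindAt p) (signAt σ)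
  ⇒ g i t j<n ev ev′ nn = toWitness (to (T-⇒ (premise (suc i) (suc (suc i ℕ.+ t))) _)
    (to (allB-range1 _ n) (to (allB-range1 _ n) g i (ℕₚ.<-trans i<j j<n)) (suc i ℕ.+ t) j<n)
    (from T-∧ (ℕₚ.<⇒<ᵇ (s≤s i<j) , from T-∧ (from (υ-even p i) ev , from T-∧ (from (υ-even p (suc i ℕ.+ t)) ev′ ,
      ≡.subst (T ∘ prefixOK) (≡.sym (between-word p i t)) (from (prefixOK-word _ t) nn))))))
    where
    i<j : i < suc i ℕ.+ t
    i<j = s≤s (ℕₚ.m≤m+n i t)
  ⇐ : GarageAt n (kindAt p) (signAt σ) → T (garageB n p σ)
  ⇐ g = from (allB-range1 _ n) λ i i<n → from (allB-range1 _ n) λ j j<n → from (T-⇒ (premise (suc i) (suc j)) _) λ b →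
    let (i<j , b₁) = to (T-∧ {suc i <ᵇ suc j}) b
        (ev , b₂) = to (T-∧ {υ p (suc i) ≡ᵇ 2}) b₁
        (ev′ , ok) = to (T-∧ {υ p (suc j) ≡ᵇ 2}) b₂
    in pair i j (ℕₚ.≤⇒≤′ (ℕₚ.≤-pred (ℕₚ.<ᵇ⇒< (suc i) (suc j) i<j))) j<n ev ev′ ok
    where
    pair : ∀ i j → suc i ℕ.≤′ j → j < n → T (υ p (suc i) ≡ᵇ 2) → T (υ p (suc j) ≡ᵇ 2) →
           T (prefixOK (between p (suc i) (suc j))) → T (eqℤ (ith (suc i) σ) (ith (suc j) σ))
    pair i j i<j j<n ev ev′ ok with ℕₚ.m≤n⇒∃[o]m+o≡n (ℕₚ.≤′⇒≤ i<j)
    ... | t , ≡.refl = fromWitness (g i t j<n (to (υ-even p i) ev) (to (υ-even p (suc i ℕ.+ t)) ev′)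
      (to (prefixOK-word _ t) (≡.subst (T ∘ prefixOK) (between-word p i t) ok)))

T-≡ : ∀ {a b} → (T a → T b) → (T b → T a) → a ≡ b
T-≡ {true} {true} f g = ≡.refl
T-≡ {true} {false} f g with () ← f tt
T-≡ {false} {true} f g with () ← g tt
T-≡ {false} {false} f g = ≡.refl

-- The initial sign `+ 1` is a placeholder: at depth 0 no bracket imposes a sign, and the first
-- opening replaces it.
garage-scan : ∀ n p σ → compatB n p σ ∧ garageB n p σ ≡ scan n 0 (+ 1) (kindAt p) (signAt σ)
garage-scan n p σ = T-≡
  (λ t → let (c , g) = to T-∧ t in
    scan⇐ n 0 (+ 1) _ _ (CompatibleAt⇒Compatible n _ _ (to (compatB⇔ n p σ) c)) tt
      (GarageAt⇒Garage n _ _ (to (garageB⇔ n p σ) g)))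
  (λ t → let (c , _ , g) = scan⇒ n 0 (+ 1) _ _ (λ ()) t in
    from T-∧ (from (compatB⇔ n p σ) (Compatible⇒CompatibleAt n _ _ c) ,
              from (garageB⇔ n p σ) (Garage⇒GarageAt n _ _ g)))

sumOver-signs : ∀ X n p →
  sumOver (λ σ → if compatB n p σ then (if garageB n p σ then X else []) else []) (tuples n signs) ≋
  κ 0 (applyUpTo (kindAt p) n) ⊗ X
sumOver-signs X n p = ≋-trans (sumOver-cong step (tuples n signs)) (sumOver-scan X n 0 1ℤ (kindAt p) (inj₂ ≡.refl))
  where
  nested : ∀ a b → (if a then (if b then X else []) else []) ≡ (if a ∧ b then X else [])
  nested true b = ≡.refl
  nested false b = ≡.refl
  step : ∀ σ → (if compatB n p σ then (if garageB n p σ then X else []) else []) ≋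
               (if scan n 0 1ℤ (kindAt p) (signAt σ) then X else [])
  step σ = ≋-reflexive (≡.trans (nested (compatB n p σ) (garageB n p σ))
                                (cong (if_then X else []) (garage-scan n p σ)))

sumOver-Gar : ∀ n → sumOver (λ g → Rλ (lam (proj₁ g))) (Gar n) ≋
                    sumOver (λ p → κ 0 (applyUpTo (kindAt p) n) ⊗ Rλ (lam p)) (SPf n)
sumOver-Gar n = begin
  sumOver (λ g → Rλ (lam (proj₁ g))) (Gar n)
    ≈⟨ sumOver-filter _ (λ g → garageB n (proj₁ g) (proj₂ g)) (SNSPf n) ⟩
  _ ≈⟨ sumOver-filter _ (λ g → compatB n (proj₁ g) (proj₂ g)) (concatMap (λ p → map (p ,_) (tuples n signs)) (SPf n)) ⟩
  _ ≈⟨ sumOver-concatMap _ (λ p → map (p ,_) (tuples n signs)) (SPf n) ⟩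
  _ ≈⟨ sumOver-cong (λ p → ≋-trans (≋-reflexive (sumOver-map _ (p ,_) (tuples n signs))) (sumOver-signs (Rλ (lam p)) n p)) (SPf n) ⟩
  sumOver (λ p → κ 0 (applyUpTo (kindAt p) n) ⊗ Rλ (lam p)) (SPf n) ∎

-- Sorted parking functions as sequences of multiplicities

sumOver-⊕ : {A : Set} (f g : A → Sym) (xs : List A) → sumOver (λ x → f x ⊕ g x) xs ≋ sumOver f xs ⊕ sumOver g xs
sumOver-⊕ f g [] = ≋-refl
sumOver-⊕ f g (x ∷ xs) = ≋-trans (⊕-cong (≋-refl {f x ⊕ g x}) (sumOver-⊕ f g xs))
  (solve 4 (λ a b c d → (a :+ b) :+ (c :+ d) := (a :+ c) :+ (b :+ d)) ≋-refl
    (f x) (g x) (sumOver f xs) (sumOver g xs))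

sumOver-⊗ : {A : Set} (a : Sym) (f : A → Sym) (xs : List A) → sumOver (λ x → a ⊗ f x) xs ≋ a ⊗ sumOver f xs
sumOver-⊗ a f [] = ≋-sym (zeroʳ a)
sumOver-⊗ a f (x ∷ xs) = ≋-trans (⊕-cong (≋-refl {a ⊗ f x}) (sumOver-⊗ a f xs))
  (solve 3 (λ a b c → a :* b :+ a :* c := a :* (b :+ c)) ≋-refl a (f x) (sumOver f xs))

sumOver-↭ : {A : Set} (f : A → Sym) {xs ys : List A} → xs ↭ ys → sumOver f xs ≋ sumOver f ys
sumOver-↭ f ↭.refl = ≋-refl
sumOver-↭ f (↭.prep x p) = ⊕-cong (≋-refl {f x}) (sumOver-↭ f p)
sumOver-↭ f {ys = _ ∷ _ ∷ ys} (↭.swap x y p) =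
  ≋-trans (⊕-cong (≋-refl {f x}) (⊕-cong (≋-refl {f y}) (sumOver-↭ f p)))
  (solve 3 (λ a b c → a :+ (b :+ c) := b :+ (a :+ c)) ≋-refl (f x) (f y) (sumOver f ys))
sumOver-↭ f (↭.trans p q) = ≋-trans (sumOver-↭ f p) (sumOver-↭ f q)

sumOver-cong-∈ : {A : Set} {f g : A → Sym} (xs : List A) → (∀ {x} → x ∈ xs → f x ≋ g x) → sumOver f xs ≋ sumOver g xs
sumOver-cong-∈ [] p = ≋-refl
sumOver-cong-∈ (x ∷ xs) p = ⊕-cong (p (here ≡.refl)) (sumOver-cong-∈ xs (p ∘ there))

-- Follows the recursion of `conv`, so that summing a weight that splits off its first entry gives a
-- convolution.
distribute : (ℕ → List (List ℕ)) → (ℕ → ℕ) → ℕ → List (List ℕ)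
distribute L g zero = map (g 0 ∷_) (L 0)
distribute L g (suc m) = map (g 0 ∷_) (L (suc m)) ++ distribute L (g ∘ suc) m

-- The lists (α_k, …, α_N) of the numbers of cars preferring the last n spots, when m cars prefer
-- one of these; the parking condition is that m never exceeds n.
occupancies : ℕ → ℕ → List (List ℕ)
occupancies zero zero = [] ∷ []
occupancies zero (suc m) = []
occupancies (suc n) m = if m ≤ᵇ suc n then distribute (occupancies n) id m else []

onHead : (ℕ → Sym) → (List ℕ → Sym) → List ℕ → Sym
onHead f X [] = []
onHead f X (x ∷ a) = f x ⊗ X a

sumOver-distribute-cong : ∀ {V W} → (∀ x a → V (x ∷ a) ≋ W (x ∷ a)) → ∀ L g m →
  sumOver V (distribute L g m) ≋ sumOver W (distribute L g m)
sumOver-distribute-cong {V} {W} p L g = go g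
  where
  prefixed : ∀ x m → sumOver V (map (x ∷_) (L m)) ≋ sumOver W (map (x ∷_) (L m))
  prefixed x m = begin
    sumOver V (map (x ∷_) (L m))   ≡⟨ sumOver-map V (x ∷_) (L m) ⟩
    sumOver (V ∘ (x ∷_)) (L m)     ≈⟨ sumOver-cong (p x) (L m) ⟩
    sumOver (W ∘ (x ∷_)) (L m)     ≡⟨ sumOver-map W (x ∷_) (L m) ⟨
    sumOver W (map (x ∷_) (L m))   ∎
  go : ∀ g m → sumOver V (distribute L g m) ≋ sumOver W (distribute L g m)
  go g zero = prefixed (g 0) 0
  go g (suc m) = begin
    sumOver V (map (g 0 ∷_) (L (suc m)) ++ distribute L (g ∘ suc) m)
      ≈⟨ sumOver-++ V (map (g 0 ∷_) (L (suc m))) _ ⟩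
    _ ≈⟨ ⊕-cong (prefixed (g 0) (suc m)) (go (g ∘ suc) m) ⟩
    _ ≈⟨ sumOver-++ W (map (g 0 ∷_) (L (suc m))) _ ⟨
    sumOver W (distribute L g (suc m)) ∎

sumOver-onHead : ∀ f X L g m →
  sumOver (onHead f X) (distribute L g m) ≋ conv (f ∘ g) (λ j → sumOver X (L j)) m
sumOver-onHead f X L g zero =
  ≋-trans (≋-reflexive (sumOver-map (onHead f X) (g 0 ∷_) (L 0))) (sumOver-⊗ (f (g 0)) X (L 0))
sumOver-onHead f X L g (suc m) =
  ≋-trans (sumOver-++ (onHead f X) (map (g 0 ∷_) (L (suc m))) (distribute L (g ∘ suc) m))
    (⊕-cong (≋-trans (≋-reflexive (sumOver-map (onHead f X) (g 0 ∷_) (L (suc m)))) (sumOver-⊗ (f (g 0)) X (L (suc m))))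
            (sumOver-onHead f X L (g ∘ suc) m))

positive : List ℕ → List ℕ
positive = filterᵇ (λ a → not (a ≡ᵇ 0))

shWeight : List ℕ → Sym
shWeight a = Πˢ (map (sh ∘ h) (positive a))

-- `positive` drops a zero entry, and `q 0` is the unit.
shWeight-∷ : ∀ x a → shWeight (x ∷ a) ≋ onHead q shWeight (x ∷ a)
shWeight-∷ zero a = ≋-sym (≋-trans (⊗-cong (q-sh-h 0) (≋-refl {shWeight a})) (*-identityˡ (shWeight a)))
shWeight-∷ (suc x) a = ⊗-cong (≋-sym (q-sh-h (suc x))) (≋-refl {shWeight a})

sumOver-shWeight : ∀ n m → sumOver shWeight (occupancies n m) ≋ F n m
sumOver-shWeight zero zero = +-identityʳ 𝟙
sumOver-shWeight zero (suc m) = ≋-refl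
sumOver-shWeight (suc n) m with m ≤ᵇ suc n
... | false = ≋-refl
... | true = begin
  sumOver shWeight (distribute (occupancies n) id m)
    ≈⟨ sumOver-distribute-cong shWeight-∷ (occupancies n) id m ⟩
  sumOver (onHead q shWeight) (distribute (occupancies n) id m)
    ≈⟨ sumOver-onHead q shWeight (occupancies n) id m ⟩
  conv q (λ j → sumOver shWeight (occupancies n j)) m
    ≈⟨ conv-congʳ q m (λ j _ → sumOver-shWeight n j) ⟩
  conv q (F n) m ∎

garageWeight : ℕ → List ℕ → Sym
garageWeight d a = κ d (map kind a) ⊗ Rλ (positive a)

-- The three summands are supported on x = 0, x odd and x positive even, so only one of them is
-- nonzero.
garageWeight-∷ : ∀ d x a → garageWeight d (x ∷ a) ≋
  onHead δ (garageWeight (ℕ.pred d)) (x ∷ a) ⊕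
    (onHead (two · O) (garageWeight d) (x ∷ a) ⊕ onHead (opening d · conv E U) (garageWeight (suc d)) (x ∷ a))
garageWeight-∷ d zero a =
  solve 5 (λ w t u y z → w := con 1 :* w :+ ((t :* con 0) :* y :+ (u :* con 0) :* z)) ≋-refl
    (garageWeight (ℕ.pred d) a) two (opening d) (garageWeight d a) (garageWeight (suc d) a)
garageWeight-∷ d (suc x) a with odd (suc x) in eq
... | true = begin
  (two ⊗ κ d w) ⊗ (P (suc x) ⊗ ρ)
    ≈⟨ solve 6 (λ t k r p u z → (t :* k) :* (p :* r) := (t :* p) :* (k :* r) :+ (u :* con 0) :* z) ≋-refl
         two (κ d w) ρ (P (suc x)) (opening d) (garageWeight (suc d) a) ⟩
  ((two ⊗ P (suc x)) ⊗ garageWeight d a) ⊕ ((opening d ⊗ []) ⊗ garageWeight (suc d) a)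
    ≈⟨ ⊕-cong (≋-refl {(two ⊗ P (suc x)) ⊗ garageWeight d a})
         (⊗-cong (⊗-cong (≋-refl {opening d}) (≋-sym (EU-odd (suc x) eq))) (≋-refl {garageWeight (suc d) a})) ⟩
  ((two ⊗ P (suc x)) ⊗ garageWeight d a) ⊕ ((opening d ⊗ conv E U (suc x)) ⊗ garageWeight (suc d) a) ∎
  where
  w : List Kind
  w = map kind a
  ρ : Sym
  ρ = Rλ (positive a)
... | false = begin
  (opening d ⊗ κ (suc d) w) ⊗ (Reven ⊗ ρ)
    ≈⟨ solve 6 (λ u k r p t z → (u :* k) :* (p :* r) := (t :* con 0) :* z :+ (u :* p) :* (k :* r)) ≋-refl
         (opening d) (κ (suc d) w) ρ Reven two (garageWeight d a) ⟩
  ((two ⊗ []) ⊗ garageWeight d a) ⊕ ((opening d ⊗ Reven) ⊗ garageWeight (suc d) a)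
    ≈⟨ ⊕-cong (≋-refl {(two ⊗ []) ⊗ garageWeight d a})
         (⊗-cong (⊗-cong (≋-refl {opening d}) Reven≋) (≋-refl {garageWeight (suc d) a})) ⟩
  ((two ⊗ []) ⊗ garageWeight d a) ⊕ ((opening d ⊗ conv E U (suc x)) ⊗ garageWeight (suc d) a) ∎
  where
  w : List Kind
  w = map kind a
  ρ : Sym
  ρ = Rλ (positive a)
  -- The form that `R (suc x)` takes once the case split has resolved its parity test.
  Reven : Sym
  Reven = Σˢ (map (λ j → P (2 ℕ.* suc j) ⊗ P (suc x ℕ.∸ 2 ℕ.* suc j)) (upTo ℕ.⌊ suc x /2⌋))
  Reven≋ : Reven ≋ conv E U (suc x)
  Reven≋ = ≋-trans (≋-reflexive (cong (λ b → if b then P (suc x) else Reven) (≡.sym eq))) (R-even (suc x) eq)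

sumOver-garageWeight : ∀ n d m → sumOver (garageWeight d) (occupancies n m) ≋ G n d m
sumOver-garageWeight zero d zero = equal λ _ _ → ≡.refl
sumOver-garageWeight zero d (suc m) = ≋-refl
sumOver-garageWeight (suc n) d m with m ≤ᵇ suc n
... | false = ≋-refl
... | true = begin
  sumOver (garageWeight d) L
    ≈⟨ sumOver-distribute-cong {garageWeight d} {λ a → W₀ a ⊕ (W₁ a ⊕ W₂ a)} (garageWeight-∷ d) (occupancies n) id m ⟩
  sumOver (λ a → W₀ a ⊕ (W₁ a ⊕ W₂ a)) L
    ≈⟨ ≋-trans (sumOver-⊕ W₀ (λ a → W₁ a ⊕ W₂ a) L) (⊕-cong (≋-refl {sumOver W₀ L}) (sumOver-⊕ W₁ W₂ L)) ⟩
  sumOver W₀ L ⊕ (sumOver W₁ L ⊕ sumOver W₂ L)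
    ≈⟨ ⊕-cong (part δ (ℕ.pred d)) (⊕-cong (part (two · O) d) (part (opening d · conv E U) (suc d))) ⟩
  conv δ (G n (ℕ.pred d)) m ⊕ (conv (two · O) (G n d) m ⊕ conv (opening d · conv E U) (G n (suc d)) m)
    ≈⟨ ⊕-cong (conv-identityˡ (G n (ℕ.pred d)) m)
         (⊕-cong (≋-refl {conv (two · O) (G n d) m}) (conv-·ˡ (opening d) (conv E U) (G n (suc d)) m)) ⟩
  Gstep n d m ∎
  where
  L : List (List ℕ)
  L = distribute (occupancies n) id m
  W₀ W₁ W₂ : List ℕ → Sym
  W₀ = onHead δ (garageWeight (ℕ.pred d))
  W₁ = onHead (two · O) (garageWeight d)
  W₂ = onHead (opening d · conv E U) (garageWeight (suc d))
  part : ∀ f d′ → sumOver (onHead f (garageWeight d′)) L ≋ conv f (G n d′) m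
  part f d′ = ≋-trans (sumOver-onHead f (garageWeight d′) (occupancies n) id m)
                      (conv-congʳ f m (λ j _ → sumOver-garageWeight n d′ j))

-- Sorted parking functions correspond to occupancy lists

data Fits : ℕ → ℕ → List ℕ → Set where
  none : Fits 0 0 []
  spot : ∀ {n m m′ x a} → x ℕ.+ m′ ≡ m → m ≤ suc n → Fits n m′ a → Fits (suc n) m (x ∷ a)

∈-distribute⁻ : ∀ L g m {a} → a ∈ distribute L g m →
  ∃ λ i → ∃ λ j → ∃ λ b → i ℕ.+ j ≡ m × b ∈ L j × a ≡ g i ∷ b
∈-distribute⁻ L g zero a∈ with ∈ₚ.∈-map⁻ (g 0 ∷_) a∈
... | b , b∈ , eq = 0 , 0 , b , ≡.refl , b∈ , eq
∈-distribute⁻ L g (suc m) a∈ with ∈ₚ.∈-++⁻ (map (g 0 ∷_) (L (suc m))) a∈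
... | inj₁ a∈′ with ∈ₚ.∈-map⁻ (g 0 ∷_) a∈′
...   | b , b∈ , eq = 0 , suc m , b , ≡.refl , b∈ , eq
∈-distribute⁻ L g (suc m) a∈ | inj₂ a∈′ with ∈-distribute⁻ L (g ∘ suc) m a∈′
...   | i , j , b , i+j≡m , b∈ , eq = suc i , j , b , cong suc i+j≡m , b∈ , eq

∈-distribute⁺ : ∀ L g i j {b} → b ∈ L j → g i ∷ b ∈ distribute L g (i ℕ.+ j)
∈-distribute⁺ L g zero zero b∈ = ∈ₚ.∈-map⁺ (g 0 ∷_) b∈
∈-distribute⁺ L g zero (suc j) b∈ = ∈ₚ.∈-++⁺ˡ (∈ₚ.∈-map⁺ (g 0 ∷_) b∈)
∈-distribute⁺ L g (suc i) j b∈ = ∈ₚ.∈-++⁺ʳ _ (∈-distribute⁺ L (g ∘ suc) i j b∈)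

∈-occupancies⁻ : ∀ n m {a} → a ∈ occupancies n m → Fits n m a
∈-occupancies⁻ zero zero (here ≡.refl) = none
∈-occupancies⁻ (suc n) m a∈ with m ≤ᵇ suc n | ℕₚ.≤ᵇ⇒≤ m (suc n)
... | true | m≤ with ∈-distribute⁻ (occupancies n) id m a∈
...   | i , j , b , i+j≡m , b∈ , ≡.refl = spot i+j≡m (m≤ tt) (∈-occupancies⁻ n j b∈)

∈-occupancies⁺ : ∀ {n m a} → Fits n m a → a ∈ occupancies n m
∈-occupancies⁺ none = here ≡.refl
∈-occupancies⁺ {suc n} {m} (spot {m′ = m′} {x} ≡.refl m≤ fits) with m ≤ᵇ suc n | ℕₚ.≤⇒≤ᵇ m≤
... | true | _ = ∈-distribute⁺ (occupancies n) id x m′ (∈-occupancies⁺ fits)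

distribute-unique : ∀ L → (∀ j → Unique (L j)) → ∀ g → (∀ {i j} → g i ≡ g j → i ≡ j) → ∀ m → Unique (distribute L g m)
distribute-unique L L! g g-inj zero = Uniqueₚ.map⁺ Listₚ.∷-injectiveʳ (L! 0)
distribute-unique L L! g g-inj (suc m) =
  Uniqueₚ.++⁺ (Uniqueₚ.map⁺ Listₚ.∷-injectiveʳ (L! (suc m)))
    (distribute-unique L L! (g ∘ suc) (ℕₚ.suc-injective ∘ g-inj) m) disjoint
  where
  disjoint : ∀ {a} → a ∈ map (g 0 ∷_) (L (suc m)) × a ∈ distribute L (g ∘ suc) m → _
  disjoint (a∈ , a∈′) with ∈ₚ.∈-map⁻ (g 0 ∷_) a∈ | ∈-distribute⁻ L (g ∘ suc) m a∈′
  ... | _ , _ , ≡.refl | i , _ , _ , _ , _ , eq with () ← g-inj (Listₚ.∷-injectiveˡ eq)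

occupancies-unique : ∀ n m → Unique (occupancies n m)
occupancies-unique zero zero = [] ∷ []
occupancies-unique zero (suc m) = []
occupancies-unique (suc n) m with m ≤ᵇ suc n
... | true = distribute-unique (occupancies n) (occupancies-unique n) id id m
... | false = []

expand : ℕ → List ℕ → List ℕ
expand k [] = []
expand k (x ∷ a) = replicate x k ++ expand (suc k) a

expand-≥ : ∀ k a → All (k ≤_) (expand k a)
expand-≥ k [] = []
expand-≥ k (x ∷ a) = Allₚ.++⁺ (Allₚ.replicate⁺ x ℕₚ.≤-refl) (All.map ℕₚ.<⇒≤ (expand-≥ (suc k) a))

expand-< : ∀ k a → All (_< k ℕ.+ length a) (expand k a)
expand-< k [] = []
expand-< k (x ∷ a) rewrite ℕₚ.+-suc k (length a) =
  Allₚ.++⁺ (Allₚ.replicate⁺ x (s≤s (ℕₚ.m≤m+n k (length a)))) (expand-< (suc k) a)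

sortedB-∷ : ∀ {k q} → All (k ≤_) q → T (sortedB q) → T (sortedB (k ∷ q))
sortedB-∷ [] _ = tt
sortedB-∷ (k≤x ∷ _) s = from T-∧ (ℕₚ.≤⇒≤ᵇ k≤x , s)

sortedB-replicate : ∀ x {k q} → All (k ≤_) q → T (sortedB q) → T (sortedB (replicate x k ++ q))
sortedB-replicate zero _ s = s
sortedB-replicate (suc x) k≤ s =
  sortedB-∷ (Allₚ.++⁺ (Allₚ.replicate⁺ x ℕₚ.≤-refl) k≤) (sortedB-replicate x k≤ s)

expand-sorted : ∀ k a → T (sortedB (expand k a))
expand-sorted k [] = tt
expand-sorted k (x ∷ a) = sortedB-replicate x (All.map ℕₚ.<⇒≤ (expand-≥ (suc k) a)) (expand-sorted (suc k) a)

sortedB-tail : ∀ x p → T (sortedB (x ∷ p)) → T (sortedB p)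
sortedB-tail x [] s = tt
sortedB-tail x (y ∷ p) s = proj₂ (to (T-∧ {x ≤ᵇ y}) s)

sortedB-head : ∀ x p → T (sortedB (x ∷ p)) → All (x ≤_) p
sortedB-head x [] s = []
sortedB-head x (y ∷ p) s = let x≤y = ℕₚ.≤ᵇ⇒≤ x y (proj₁ (to (T-∧ {x ≤ᵇ y}) s)) in
  x≤y ∷ All.map (ℕₚ.≤-trans x≤y) (sortedB-head y p (sortedB-tail x (y ∷ p) s))

sort-sorted : ∀ p → T (sortedB p) → sort p ≡ p
sort-sorted [] s = ≡.refl
sort-sorted (x ∷ p) s rewrite sort-sorted p (sortedB-tail x p s) with p | sortedB-head x p s
... | [] | _ = ≡.refl
... | y ∷ p | x≤y ∷ _ = insert-≤ p x≤y

boundB-∷ : ∀ {i x} p → 1 ≤ x → x ≤ i → T (boundB (suc i) p) → T (boundB i (x ∷ p))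
boundB-∷ p 1≤x x≤i b = from T-∧ (ℕₚ.≤⇒≤ᵇ 1≤x , from T-∧ (ℕₚ.≤⇒≤ᵇ x≤i , b))

-- Along a run of equal entries the bound grows while the entry stays, so the first comparison
-- suffices.
boundB-replicate : ∀ x {i k} q → 1 ≤ k → k ≤ i → T (boundB (x ℕ.+ i) q) → T (boundB i (replicate x k ++ q))
boundB-replicate zero _ _ _ b = b
boundB-replicate (suc x) {i} {k} q 1≤k k≤i b = boundB-∷ (replicate x k ++ q) 1≤k k≤i
  (boundB-replicate x q 1≤k (ℕₚ.m≤n⇒m≤1+n k≤i) (≡.subst (λ j → T (boundB j q)) (≡.sym (ℕₚ.+-suc x i)) b))

-- i - 1 cars have been placed before spot k.
expand-bound : ∀ {n m a} → Fits n m a → ∀ i k → 1 ≤ k → i ℕ.+ m ≡ k ℕ.+ n → T (boundB i (expand k a))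
expand-bound none i k 1≤k _ = tt
expand-bound {suc n} {m} (spot {m′ = m′} {x} {a} ≡.refl m≤ fits) i k 1≤k eq =
  boundB-replicate x (expand (suc k) a) 1≤k k≤i (expand-bound fits (x ℕ.+ i) (suc k) (s≤s z≤n) eq′)
  where
  k≤i : k ≤ i
  -- The parking condition on the last spots turns into the bound on the next entry.
  k≤i = ℕₚ.+-cancelʳ-≤ (suc n) k i (ℕₚ.≤-trans (ℕₚ.≤-reflexive (≡.sym eq)) (ℕₚ.+-monoʳ-≤ i m≤))
  eq′ : x ℕ.+ i ℕ.+ m′ ≡ suc k ℕ.+ n
  eq′ = ≡.trans (≡.trans (cong (ℕ._+ m′) (ℕₚ.+-comm x i)) (ℕₚ.+-assoc i x m′)) (≡.trans eq (ℕₚ.+-suc k n))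

Fits-length : ∀ {n m a} → Fits n m a → length a ≡ n
Fits-length none = ≡.refl
Fits-length (spot _ _ fits) = cong suc (Fits-length fits)

Fits-≤ : ∀ {n m a} → Fits n m a → m ≤ n
Fits-≤ none = z≤n
Fits-≤ (spot _ m≤ _) = m≤

expand-length : ∀ {n m a} → Fits n m a → ∀ k → length (expand k a) ≡ m
expand-length none k = ≡.refl
expand-length (spot {x = x} ≡.refl _ fits) k = ≡.trans (Listₚ.length-++ (replicate x k))
  (cong₂ ℕ._+_ (Listₚ.length-replicate x) (expand-length fits (suc k)))

α-∷-≡ : ∀ k p → α k (k ∷ p) ≡ suc (α k p)
α-∷-≡ k p with k ≡ᵇ k | ℕₚ.≡⇒≡ᵇ k k ≡.refl
... | true | _ = ≡.refl

α-∷-≢ : ∀ {k x} p → k ≢ x → α k (x ∷ p) ≡ α k p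
α-∷-≢ {k} {x} p k≢x with k ≡ᵇ x | ℕₚ.≡ᵇ⇒≡ k x
... | true | eq with () ← k≢x (eq tt)
... | false | _ = ≡.refl

α-> : ∀ k p → All (k <_) p → α k p ≡ 0
α-> k [] [] = ≡.refl
α-> k (x ∷ p) (k<x ∷ k<) = ≡.trans (α-∷-≢ p (ℕₚ.<⇒≢ k<x)) (α-> k p k<)

α-replicate-≡ : ∀ x k q → α k (replicate x k ++ q) ≡ x ℕ.+ α k q
α-replicate-≡ zero k q = ≡.refl
α-replicate-≡ (suc x) k q = ≡.trans (α-∷-≡ k (replicate x k ++ q)) (cong suc (α-replicate-≡ x k q))

α-replicate-≢ : ∀ x {j k} q → j ≢ k → α j (replicate x k ++ q) ≡ α j q
α-replicate-≢ zero q j≢k = ≡.refl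
α-replicate-≢ (suc x) {k = k} q j≢k = ≡.trans (α-∷-≢ (replicate x k ++ q) j≢k) (α-replicate-≢ x q j≢k)

α-expand : ∀ k a → applyUpTo (λ j → α (k ℕ.+ j) (expand k a)) (length a) ≡ a
α-expand k [] = ≡.refl
α-expand k (x ∷ a) = cong₂ _∷_ first (≡.trans (applyUpTo-cong (length a) later) (α-expand (suc k) a))
  where
  first : α (k ℕ.+ 0) (replicate x k ++ expand (suc k) a) ≡ x
  first rewrite ℕₚ.+-identityʳ k = ≡.trans (α-replicate-≡ x k (expand (suc k) a))
    (≡.trans (cong (x ℕ.+_) (α-> k _ (expand-≥ (suc k) a))) (ℕₚ.+-identityʳ x))
  later : ∀ j → α (k ℕ.+ suc j) (replicate x k ++ expand (suc k) a) ≡ α (suc k ℕ.+ j) (expand (suc k) a)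
  later j rewrite ℕₚ.+-suc k j = α-replicate-≢ x (expand (suc k) a) (ℕₚ.>⇒≢ (s≤s (ℕₚ.m≤m+n k j)))

Expansion : ℕ → ℕ → List ℕ → Set
Expansion c k p = ∃ λ a → Fits c (length p) a × p ≡ expand k a

skip-spot : ∀ {c k p} → Expansion c (suc k) p → Expansion (suc c) k p
skip-spot (a , fits , p≡) = 0 ∷ a , spot ≡.refl (ℕₚ.m≤n⇒m≤1+n (Fits-≤ fits)) fits , p≡

add-car : ∀ {c k p} → length p ≤ c → Expansion (suc c) k p → Expansion (suc c) k (k ∷ p)
add-car {k = k} p≤c (y ∷ a , spot y+m≡ _ fits , p≡) = suc y ∷ a , spot (cong suc y+m≡) (s≤s p≤c) fits , cong (k ∷_) p≡

-- A first entry above `k` means that spot `k` gets no further car, and one equal to `k` adds a car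
-- to it. The position `i` of the next entry enters through the equation, which converts bounds on
-- entries into bounds on the number of remaining cars.
expand-surjective : ∀ c k i p → T (sortedB p) → All (k ≤_) p → All (_< k ℕ.+ c) p → T (boundB i p) →
  i ℕ.+ length p ≡ k ℕ.+ c → Expansion c k p
expand-surjective zero k i [] s lo hi b eq = [] , none , ≡.refl
expand-surjective zero k i (x ∷ p) s (k≤x ∷ _) (x<k ∷ _) b eq =
  ⊥-elim (ℕₚ.<⇒≱ (≡.subst (x <_) (ℕₚ.+-identityʳ k) x<k) k≤x)
expand-surjective (suc c) k i [] s lo hi b eq =
  skip-spot (expand-surjective c (suc k) i [] s [] [] b (≡.trans eq (ℕₚ.+-suc k c)))
expand-surjective (suc c) k i (x ∷ p) s (k≤x ∷ lo) (x< ∷ hi) b eq =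
  [ (λ k<x → skip-spot (expand-surjective c (suc k) i (x ∷ p) s
      (k<x ∷ All.map (ℕₚ.≤-trans k<x) (sortedB-head x p s))
      (≡.subst (λ N → All (_< N) (x ∷ p)) (ℕₚ.+-suc k c) (x< ∷ hi)) b (≡.trans eq (ℕₚ.+-suc k c))))
  , (λ k≡x → ≡.subst (λ y → Expansion (suc c) k (y ∷ p)) k≡x (add-car p≤c
      (expand-surjective (suc c) k (suc i) p (sortedB-tail x p s) lo hi (proj₂ b′)
        (≡.trans (≡.sym (ℕₚ.+-suc i (length p))) eq))))
  ]′ (ℕₚ.m≤n⇒m<n∨m≡n k≤x)
  where
  b′ : T (x ≤ᵇ i) × T (boundB (suc i) p)
  b′ = to (T-∧ {x ≤ᵇ i}) (proj₂ (to (T-∧ {1 ≤ᵇ x}) b))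
  k≤i : k ≤ i
  k≤i = ℕₚ.≤-trans k≤x (ℕₚ.≤ᵇ⇒≤ x i (proj₁ b′))
  p≤c : length p ≤ c
  -- From k ≤ x ≤ i and the equation: the cars still to be placed number at most the remaining
  -- spots.
  p≤c = ℕₚ.≤-pred (ℕₚ.+-cancelˡ-≤ k _ _ (ℕₚ.≤-trans (ℕₚ.+-monoˡ-≤ (suc (length p)) k≤i) (ℕₚ.≤-reflexive eq)))

tuples-cartesianProduct : ∀ {A : Set} n (xs : List A) →
  tuples (suc n) xs ≡ cartesianProductWith _∷_ xs (tuples n xs)
tuples-cartesianProduct n xs = go xs
  where
  go : ∀ ys → concatMap (λ y → map (y ∷_) (tuples n xs)) ys ≡ cartesianProductWith _∷_ ys (tuples n xs)
  go [] = ≡.refl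
  go (y ∷ ys) = cong (map (y ∷_) (tuples n xs) ++_) (go ys)

tuples-unique : ∀ {A : Set} n {xs : List A} → Unique xs → Unique (tuples n xs)
tuples-unique zero xs! = [] ∷ []
tuples-unique (suc n) {xs} xs! rewrite tuples-cartesianProduct n xs =
  Uniqueₚ.cartesianProductWith⁺ _∷_ Listₚ.∷-injective xs! (tuples-unique n xs!)

∈-tuples⁻ : ∀ {A : Set} n (xs : List A) {p} → p ∈ tuples n xs → length p ≡ n × All (_∈ xs) p
∈-tuples⁻ zero xs (here ≡.refl) = ≡.refl , []
∈-tuples⁻ (suc n) xs p∈ rewrite tuples-cartesianProduct n xs
  with ∈ₚ.∈-cartesianProductWith⁻ _∷_ xs (tuples n xs) p∈
... | x , p , x∈ , p∈′ , ≡.refl = let (len , all) = ∈-tuples⁻ n xs p∈′ in cong suc len , x∈ ∷ all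

∈-tuples⁺ : ∀ {A : Set} {xs : List A} {p} → All (_∈ xs) p → p ∈ tuples (length p) xs
∈-tuples⁺ [] = here ≡.refl
∈-tuples⁺ {xs = xs} {x ∷ p} (x∈ ∷ all) rewrite tuples-cartesianProduct (length p) xs =
  ∈ₚ.∈-cartesianProductWith⁺ _∷_ x∈ (∈-tuples⁺ all)

SPf-unique : ∀ n → Unique (SPf n)
SPf-unique n = Uniqueₚ.filter⁺ (λ p → T? (sortedB p ∧ isPF p))
  (tuples-unique n (Uniqueₚ.map⁺ ℕₚ.suc-injective (Uniqueₚ.upTo⁺ n)))

∈-SPf⁻ : ∀ n {p} → p ∈ SPf n → ∃ λ a → a ∈ occupancies n n × p ≡ expand 1 a
∈-SPf⁻ n {p} p∈ with ∈ₚ.∈-filter⁻ (λ p → T? (sortedB p ∧ isPF p)) {xs = tuples n (range1 n)} p∈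
... | p∈′ , t with ∈-tuples⁻ n (range1 n) p∈′ | to (T-∧ {sortedB p}) t
...   | ≡.refl , all | s , pf
  with expand-surjective (length p) 1 1 p s (All.map (proj₁ ∘ range) all) (All.map (proj₂ ∘ range) all)
         (≡.subst (T ∘ boundB 1) (sort-sorted p s) pf) ≡.refl
  where
  range : ∀ {x} → x ∈ range1 (length p) → 1 ≤ x × x < suc (length p)
  range x∈ with ∈ₚ.∈-map⁻ suc x∈
  ... | y , y∈ , ≡.refl = s≤s z≤n , s≤s (∈ₚ.∈-upTo⁻ y∈)
...     | a , fits , p≡ = a , ∈-occupancies⁺ fits , p≡

∈-SPf⁺ : ∀ n {a} → a ∈ occupancies n n → expand 1 a ∈ SPf n
∈-SPf⁺ n {a} a∈ = ∈ₚ.∈-filter⁺ (λ p → T? (sortedB p ∧ isPF p)) in-tuples (from T-∧ (s , pf))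
  where
  fits : Fits n n a
  fits = ∈-occupancies⁻ n n a∈
  s : T (sortedB (expand 1 a))
  s = expand-sorted 1 a
  pf : T (isPF (expand 1 a))
  pf = ≡.subst (T ∘ boundB 1) (≡.sym (sort-sorted (expand 1 a) s)) (expand-bound fits 1 1 (s≤s z≤n) ≡.refl)
  entry : ∀ {x} → 1 ≤ x × x < suc (length a) → x ∈ range1 (length a)
  entry {suc x} (_ , s≤s x<) = ∈ₚ.∈-map⁺ suc (∈ₚ.∈-upTo⁺ x<)
  in-tuples : expand 1 a ∈ tuples n (range1 n)
  in-tuples = ≡.subst₂ (λ l r → expand 1 a ∈ tuples l (range1 r)) (expand-length fits 1) (Fits-length fits)
    (∈-tuples⁺ (All.map entry (All.zip (expand-≥ 1 a , expand-< 1 a))))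

counts : ℕ → List ℕ → List ℕ
counts n p = applyUpTo (λ k → α (suc k) p) n

counts-expand : ∀ n {a} → a ∈ occupancies n n → counts n (expand 1 a) ≡ a
counts-expand n {a} a∈ = ≡.trans (cong (λ l → counts l (expand 1 a)) (≡.sym (Fits-length (∈-occupancies⁻ n n a∈)))) (α-expand 1 a)

-- Repetition-free lists with the same members are permutations of each other; `counts` undoes
-- `expand 1` on occupancies, so no expansion is repeated.
SPf-↭ : ∀ n → SPf n ↭ map (expand 1) (occupancies n n)
SPf-↭ n = ∼bag⇒↭ (unique∧set⇒bag (SPf-unique n) expand! (mk⇔ ⇒ ⇐))
  where
  expand! : Unique (map (expand 1) (occupancies n n))
  expand! = Uniqueₚ.map⁻ {f = counts n} (≡.subst Unique (≡.sym (≡.trans (≡.sym (Listₚ.map-∘ (occupancies n n)))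
    (Listₚ.map-id-local (All.tabulate (counts-expand n))))) (occupancies-unique n n))
  ⇒ : ∀ {p} → p ∈ SPf n → p ∈ map (expand 1) (occupancies n n)
  ⇒ p∈ with ∈-SPf⁻ n p∈
  ... | a , a∈ , ≡.refl = ∈ₚ.∈-map⁺ (expand 1) a∈
  ⇐ : ∀ {p} → p ∈ map (expand 1) (occupancies n n) → p ∈ SPf n
  ⇐ p∈ with ∈ₚ.∈-map⁻ (expand 1) p∈
  ... | a , a∈ , ≡.refl = ∈-SPf⁺ n a∈

lam-expand : ∀ n {a} → a ∈ occupancies n n → lam (expand 1 a) ≡ positive a
lam-expand n {a} a∈ = cong positive (≡.trans (≡.trans (≡.sym (Listₚ.map-∘ (upTo (length p)))) (Listₚ.map-applyUpTo id _ (length p)))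
  (≡.trans (cong (λ l → counts l p) (expand-length (∈-occupancies⁻ n n a∈) 1)) (counts-expand n a∈)))
  where
  p : List ℕ
  p = expand 1 a

sumOver-SPf : ∀ (W : List ℕ → Sym) n → sumOver W (SPf n) ≋ sumOver (W ∘ expand 1) (occupancies n n)
sumOver-SPf W n = ≋-trans (sumOver-↭ W (SPf-↭ n)) (≋-reflexive (sumOver-map W (expand 1) (occupancies n n)))

-- Identification of both sides with the two counts

sh-sumOver : {A : Set} (f : A → Sym) (xs : List A) → sh (sumOver f xs) ≋ sumOver (sh ∘ f) xs
sh-sumOver f [] = ≋-refl
sh-sumOver f (x ∷ xs) = ≋-trans (≋-reflexive (sh-⊕ (f x) (sumOver f xs))) (⊕-cong (≋-refl {sh (f x)}) (sh-sumOver f xs))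

sh-Πˢ : ∀ μ → sh (hλ μ) ≋ Πˢ (map (sh ∘ h) μ)
sh-Πˢ [] = ≋-refl
sh-Πˢ (x ∷ μ) = ≋-trans (sh-⊗ (h x) (hλ μ)) (⊗-cong (≋-refl {sh (h x)}) (sh-Πˢ μ))

SH-F : ∀ n → SH n ≋ F n n
SH-F n = begin
  sh (sumOver (hλ ∘ lam) (SPf n))                               ≈⟨ sh-sumOver (hλ ∘ lam) (SPf n) ⟩
  sumOver (sh ∘ hλ ∘ lam) (SPf n)                               ≈⟨ sumOver-SPf (sh ∘ hλ ∘ lam) n ⟩
  sumOver (sh ∘ hλ ∘ lam ∘ expand 1) (occupancies n n)
    ≈⟨ sumOver-cong-∈ (occupancies n n) (λ {a} a∈ → ≋-trans (≋-reflexive (cong (sh ∘ hλ) (lam-expand n a∈))) (sh-Πˢ (positive a))) ⟩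
  sumOver shWeight (occupancies n n)                            ≈⟨ sumOver-shWeight n n ⟩
  F n n                                                         ∎

Gar-G : ∀ n → sumOver (λ g → Rλ (lam (proj₁ g))) (Gar n) ≋ G n 0 n
Gar-G n = begin
  sumOver (λ g → Rλ (lam (proj₁ g))) (Gar n)                    ≈⟨ sumOver-Gar n ⟩
  sumOver W (SPf n)                                             ≈⟨ sumOver-SPf W n ⟩
  sumOver (W ∘ expand 1) (occupancies n n)                      ≈⟨ sumOver-cong-∈ (occupancies n n) (λ a∈ → ≋-reflexive (weight a∈)) ⟩
  sumOver (garageWeight 0) (occupancies n n)                    ≈⟨ sumOver-garageWeight n 0 n ⟩
  G n 0 n                                                       ∎
  where
  W : List ℕ → Sym
  W p = κ 0 (applyUpTo (kindAt p) n) ⊗ Rλ (lam p)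
  weight : ∀ {a} → a ∈ occupancies n n → W (expand 1 a) ≡ garageWeight 0 a
  weight {a} a∈ = cong₂ (λ w μ → κ 0 w ⊗ Rλ μ)
    (≡.trans (≡.sym (Listₚ.map-applyUpTo (λ k → α (suc k) (expand 1 a)) kind n)) (cong (map kind) (counts-expand n a∈)))
    (lam-expand n a∈)

theorem3p9 : (n : ℕ) → 1 ≤ n → SH n ≈ Σˢ (map (λ g → Rλ (lam (proj₁ g))) (Gar n))
theorem3p9 n _ = ≋⇒≈ (≋-trans (SH-F n) (≋-trans (≋-sym (G≃F n)) (≋-sym (Gar-G n))))
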